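{- Let $A$ be a (possibly infinite) alphabet and let $<$ be the generalized lexicographic order induced by a sequence $(<_n)_{n\in\mathbb{N}}$ of total orders on $A$. Then every infinite word $w$ over $A$ has a unique nonincreasing factorization into (finite and infinite) generalized Lyndon words; that is, there is exactly one sequence $(\ell_i)_{1\le i\le n}$ (if $n\in\mathbb{N}$), or $(\ell_i)_{i\ge 1}$ (if $n=\infty$), of generalized Lyndon words such that $w=\prod_{i=1}^n \ell_i$ and $\ell_i^\omega\ge \ell_{i+1}^\omega$ for all integers $i\in[1,n)$.
   Context: $\mathbb{N}=\{1,2,3,\dots\}$. Words are finite or infinite (to the right) sequences of letters of $A$. For each $n\in\mathbb{N}$ let $<_n$ be a total order on $A$. The generalized lexicographic order $<$ induced by $(<_n)_{n\in\mathbb{N}}$ on finite and infinite words is: $x<y$ if and only if $x$ is a proper prefix of $y$, or $x=pas$ and $y=pbs'$ for words $p,s,s'$ ($p$ finite) and letters $a,b$ with $a<_{|p|+1}b$. For a nonempty finite word $u$, $u^\omega$ is the infinite word $uuu\cdots$; if $u$ is infinite, $u^\omega=u$ by convention. A nonempty finite word $w$ is generalized Lyndon if $uv<vu$ for every factorization $w=uv$ with $u,v$ both nonempty. An infinite word $w$ is generalized Lyndon if $w<v$ for every factorization $w=uv$ with $u$ a nonempty finite word. A nonincreasing generalized Lyndon factorization of a word $w$ is a product $w=\prod_{i=1}^n\ell_i$ with $n\in\mathbb{N}\cup\{\infty\}$, each $\ell_i$ generalized Lyndon, and $\ell_i^\omega\ge\ell_{i+1}^\omega$ for all $i\in[1,n)$;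 only the last factor of a factorization with finitely many terms may be an infinite word. -}

module Defs where

open import Data.List.Base using (List; []; _∷_; [_]; _++_; _∷ʳ_; length; lookup; concat; map; applyUpTo)
open import Data.List.Relation.Unary.All using (All)
open import Data.List.Relation.Unary.Linked using (Linked)
open import Data.Nat.Base using (ℕ; zero; suc)
open import Data.Nat.DivMod using (_mod_)
open import Data.Product.Base using (∃; _×_)
open import Data.Sum.Base using (_⊎_)
open import Level using (Level; _⊔_)
open import Relation.Binary.Core using (Rel)
open import Relation.Binary.PropositionalEquality.Core using (_≡_; _≢_; _≗_)
open import Relation.Nullary.Negation.Core using (¬_)

private
  variable
    a p r : Level
    A : Set a

infix  4 _≈_ _≋_ _⊑_ _IsProductOf_
infixr 5 _++ω_ _·_
infix  8 _^ω

data Word (A : Set a) : Set a where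
  fin : List A → Word A
  inf : (ℕ → A) → Word A

-- Infinite words are functions, so words are compared up to pointwise
-- equality of letters.
data _≈_ {A : Set a} : Rel (Word A) a where
  fin : ∀ {u v} → u ≡ v → fin u ≈ fin v
  inf : ∀ {x y} → x ≗ y → inf x ≈ inf y

_++ω_ : List A → (ℕ → A) → (ℕ → A)
([]      ++ω x) n       = x n
((b ∷ u) ++ω x) zero    = b
((b ∷ u) ++ω x) (suc n) = (u ++ω x) n

_·_ : List A → Word A → Word A
u · fin v = fin (u ++ v)
u · inf x = inf (u ++ω x)

_⊑_ : List A → Word A → Set _
u ⊑ w = ∃ λ s → w ≈ u · s

-- Letter n (from 0) of uuu⋯ is letter n mod |u| of u.  The value at the
-- empty word is never used, since Lyndon words are nonempty.
_^ω : Word A → Word A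
fin []      ^ω = fin []
fin (b ∷ u) ^ω = inf λ n → lookup (b ∷ u) (n mod suc (length u))
inf x       ^ω = inf x

-- The sequences (ℓ₁, …, ℓₙ) and (ℓ₁, ℓ₂, …) of words in which only the last
-- term of a finite sequence may be an infinite word.  Finite sequences are
-- nonempty: finite us l is us followed by l.
data Factors (A : Set a) : Set a where
  finite   : List (List A) → Word A → Factors A
  infinite : (ℕ → List A) → Factors A

data _≋_ {A : Set a} : Rel (Factors A) a where
  finite   : ∀ {us vs l m} → us ≡ vs → l ≈ m → finite us l ≋ finite vs m
  infinite : ∀ {f g} → f ≗ g → infinite f ≋ infinite g

data AllFactors {A : Set a} (P : Word A → Set p) : Factors A → Set (a ⊔ p) where
  finite   : ∀ {us l} → All P (map fin us ∷ʳ l) → AllFactors P (finite us l)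
  infinite : ∀ {f} → (∀ i → P (fin (f i))) → AllFactors P (infinite f)

data LinkedFactors {A : Set a} (R : Rel (Word A) r) : Factors A → Set (a ⊔ r) where
  finite   : ∀ {us l} → Linked R (map fin us ∷ʳ l) → LinkedFactors R (finite us l)
  infinite : ∀ {f} → (∀ i → R (fin (f i)) (fin (f (suc i)))) → LinkedFactors R (infinite f)

partialProduct : (ℕ → List A) → ℕ → List A
partialProduct f n = concat (applyUpTo f n)

-- An infinite product is the limit of its partial products: the word whose
-- finite prefixes are exactly the prefixes of the partial products.
_IsProductOf_ : Word A → Factors A → Set _
w IsProductOf finite us l = w ≈ concat us · l
w IsProductOf infinite f  =
  (∀ n → partialProduct f n ⊑ w) ×
  (∀ u → u ⊑ w → ∃ λ n → u ⊑ fin (partialProduct f n))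

-- Positions count from 0: lt n compares the letters preceded by n letters.
module _ {a ℓ} {A : Set a} (lt : ℕ → Rel A ℓ) where

  data GenLex (x y : Word A) : Set (a ⊔ ℓ) where
    properPrefix : ∀ u s → ¬ (s ≈ fin []) →
                   x ≈ fin u → y ≈ u · s → GenLex x y
    firstDiff    : ∀ u b c s t → lt (length u) b c →
                   x ≈ u · [ b ] · s → y ≈ u · [ c ] · t → GenLex x y

  GenLexEq : Rel (Word A) (a ⊔ ℓ)
  GenLexEq x y = GenLex x y ⊎ x ≈ y

  GenLyndon : Word A → Set (a ⊔ ℓ)
  GenLyndon (fin w) =
    w ≢ [] ×
    (∀ u v → u ≢ [] → v ≢ [] → w ≡ u ++ v → GenLex (fin (u ++ v)) (fin (v ++ u)))
  GenLyndon (inf w) =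
    ∀ u v → u ≢ [] → w ≗ u ++ω v → GenLex (inf w) (inf v)

  record NonincreasingLyndonFactorization (w : Word A) (F : Factors A) : Set (a ⊔ ℓ) where
    field
      product       : w IsProductOf F
      lyndon        : AllFactors GenLyndon F
      nonincreasing : LinkedFactors (λ l m → GenLexEq (m ^ω) (l ^ω)) F

module Submission where

open import Defs
open import Axiom.ExcludedMiddle using (ExcludedMiddle)
open import Data.Empty using (⊥; ⊥-elim)
open import Data.Fin.Base using (Fin; zero; suc; toℕ)
open import Data.Fin.Properties using (toℕ-fromℕ<; toℕ-injective)
open import Data.List.Base using (List; []; _∷_; [_]; _++_; _∷ʳ_; length; lookup; concat; map; applyUpTo)
open import Data.List.Properties
  using (++-assoc; ++-cancelˡ; length-++-comm; ++-identityʳ; length-++; length-applyUpTo;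
         applyUpTo-∷ʳ; concat-++; map-++)
open import Data.List.Relation.Unary.All using (All; []; _∷_)
open import Data.List.Relation.Unary.All.Properties using (∷ʳ⁺; ∷ʳ⁻)
open import Data.List.Relation.Unary.Linked using (Linked; []; [-]; _∷_)
open import Data.Nat.Base using (ℕ; zero; suc; _+_; _∸_; _≤_; _<_; z≤n; s≤s; z<s; s<s) renaming (_⊔_ to _⊔ℕ_)
open import Data.Nat.DivMod using (_mod_; _%_; m%n<n; [m+n]%n≡m%n; m<n⇒m%n≡m)
open import Data.Nat.Induction using (<-rec)
open import Data.Nat.Properties
open import Data.Product using (∃!; ∃; ∃₂; _×_; _,_; proj₁; proj₂)
open import Data.Sum.Base using (_⊎_; inj₁; inj₂; [_,_]′)
open import Function.Base using (_∘_; case_of_)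
open import Level using (_⊔_; Lift; lift)
open import Relation.Binary.Core using (Rel)
open import Relation.Binary.Definitions using (tri<; tri≈; tri>)
open import Relation.Binary.PropositionalEquality
  using (_≡_; _≢_; _≗_; refl; sym; trans; cong; cong₂; subst; subst₂; module ≡-Reasoning)
open import Relation.Binary.Structures using (IsStrictTotalOrder)
open import Relation.Nullary using (¬_; yes; no; contradiction)

-- Write w_k for the suffix of w starting at position k. For the generalized
-- order, x < u^ω iff x < ux, hence (uv)^ω < v^ω iff u^ω < v^ω, whereas (uv)^ω need
-- not lie between u^ω and v^ω. It follows that the last factor of a nonincreasing
-- Lyndon factorization of w[0,n) starts at the last m minimizing w[m,n)^ω. Write
-- m ⇢ n; this makes ℕ a tree with root 0, and the factorizations of w into
-- infinitely many factors are its infinite paths from 0.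
--
-- Existence. A suffix w_m smaller than all later ones and at most all earlier ones
-- is the last factor of a finite factorization. If the minimal suffix recurs,
-- consecutive occurrences are joined by ⇢. If no suffix is minimal, every m has
-- finitely many successors, for otherwise w_m would be minimal, and König's lemma
-- gives an infinite path.
--
-- Uniqueness. A finite factorization is determined by its last factor, which must
-- be the minimal suffix, and an infinite Lyndon suffix excludes infinite paths.
-- Two infinite paths that share a cut agree below it, so distinct paths would be
-- disjoint from some point on, and their factors would overlap infinitely often;
-- at every overlap the pieces between consecutive cuts are shorter than the piece
-- two steps before, which is an infinite descent.

-- Infinite words: prefixes, shifts and periodic words

module _ {a} {A : Set a} where

  Agree : ℕ → Rel (ℕ → A) a
  Agree n x y = ∀ i → i < n → x i ≡ y i

  Agree-sym : ∀ {n x y} → Agree n x y → Agree n y x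
  Agree-sym e i i<n = sym (e i i<n)

  Agree-trans : ∀ {n x y z} → Agree n x y → Agree n y z → Agree n x z
  Agree-trans e f i i<n = trans (e i i<n) (f i i<n)

  Agree-weaken : ∀ {m n x y} → m ≤ n → Agree n x y → Agree m x y
  Agree-weaken m≤n e i i<m = e i (<-≤-trans i<m m≤n)

  ≗⇒Agree : ∀ {n} {x y : ℕ → A} → x ≗ y → Agree n x y
  ≗⇒Agree e i _ = e i

  ≗-sym : {x y : ℕ → A} → x ≗ y → y ≗ x
  ≗-sym e i = sym (e i)

  ≗-trans : {x y z : ℕ → A} → x ≗ y → y ≗ z → x ≗ z
  ≗-trans e f i = trans (e i) (f i)

  shift : ℕ → (ℕ → A) → (ℕ → A)
  shift k x i = x (k + i)

  ++ω-Agree : ∀ (u : List A) {n x y} → Agree n x y → Agree (length u + n) (u ++ω x) (u ++ω y)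
  ++ω-Agree []      e i       i<n     = e i i<n
  ++ω-Agree (b ∷ u) e zero    _       = refl
  ++ω-Agree (b ∷ u) e (suc i) (s<s p) = ++ω-Agree u e i p

  ++ω-prefix : ∀ (u : List A) {x y} → Agree (length u) (u ++ω x) (u ++ω y)
  ++ω-prefix u = Agree-weaken (m≤m+n (length u) 0) (++ω-Agree u {0} λ _ ())

  ++ω-congʳ : ∀ (u : List A) {x y} → x ≗ y → u ++ω x ≗ u ++ω y
  ++ω-congʳ []      e i       = e i
  ++ω-congʳ (b ∷ u) e zero    = refl
  ++ω-congʳ (b ∷ u) e (suc i) = ++ω-congʳ u e i

  ++ω-assoc : ∀ (u v : List A) {x} → (u ++ v) ++ω x ≗ u ++ω (v ++ω x)
  ++ω-assoc []      v i       = refl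
  ++ω-assoc (b ∷ u) v zero    = refl
  ++ω-assoc (b ∷ u) v (suc i) = ++ω-assoc u v i

  shift-++ω : ∀ (u : List A) {x} → shift (length u) (u ++ω x) ≗ x
  shift-++ω []      i = refl
  shift-++ω (b ∷ u) i = shift-++ω u i

  ++ω-at : ∀ (u : List A) {x} → (u ++ω x) (length u) ≡ x 0
  ++ω-at []      = refl
  ++ω-at (b ∷ u) = ++ω-at u

  split-at : ∀ {n} (u v : List A) {x y} → n < length u → n < length v → Agree n (u ++ω x) (v ++ω y) →
             ∃ λ p → ∃₂ λ s t → length p ≡ n × u ≡ p ++ (u ++ω x) n ∷ s × v ≡ p ++ (v ++ω y) n ∷ t
  split-at {zero}  (b ∷ u) (c ∷ v) _ _ _ = [] , u , v , refl , refl , refl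
  split-at {suc n} (b ∷ u) (c ∷ v) (s<s n<u) (s<s n<v) e with e 0 z<s
  ... | refl with split-at u v n<u n<v (λ i i<n → e (suc i) (s<s i<n))
  ...   | p , s , t , refl , eq , eq′ = b ∷ p , s , t , refl , cong (b ∷_) eq , cong (b ∷_) eq′

  applyUpTo-++ω : ∀ (x : ℕ → A) n → applyUpTo x n ++ω shift n x ≗ x
  applyUpTo-++ω x zero    i       = refl
  applyUpTo-++ω x (suc n) zero    = refl
  applyUpTo-++ω x (suc n) (suc i) = applyUpTo-++ω (x ∘ suc) n i

  applyUpTo-cong : ∀ {x y : ℕ → A} n → Agree n x y → applyUpTo x n ≡ applyUpTo y n
  applyUpTo-cong zero    e = refl
  applyUpTo-cong (suc n) e = cong₂ _∷_ (e 0 z<s) (applyUpTo-cong n λ i p → e (suc i) (s<s p))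

  applyUpTo-prefix : ∀ (u : List A) x → applyUpTo (u ++ω x) (length u) ≡ u
  applyUpTo-prefix []      x = refl
  applyUpTo-prefix (b ∷ u) x = cong (b ∷_) (applyUpTo-prefix u x)

  applyUpTo-+ : ∀ (x : ℕ → A) m n → applyUpTo x (m + n) ≡ applyUpTo x m ++ applyUpTo (shift m x) n
  applyUpTo-+ x zero    n = refl
  applyUpTo-+ x (suc m) n = cong (x 0 ∷_) (applyUpTo-+ (x ∘ suc) m n)

  ++ω-lookup : ∀ (u : List A) {x} (k : Fin (length u)) → (u ++ω x) (toℕ k) ≡ lookup u k
  ++ω-lookup (b ∷ u) zero    = refl
  ++ω-lookup (b ∷ u) (suc k) = ++ω-lookup u k

  repeat : A → List A → (ℕ → A)
  repeat b u n = lookup (b ∷ u) (n mod suc (length u))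

  repeat-unfold : ∀ b u → repeat b u ≗ (b ∷ u) ++ω repeat b u
  repeat-unfold b u i with i <? suc (length u)
  ... | yes i<l = begin
      lookup (b ∷ u) k                        ≡⟨ ++ω-lookup (b ∷ u) k ⟨
      ((b ∷ u) ++ω repeat b u) (toℕ k)        ≡⟨ cong ((b ∷ u) ++ω repeat b u) toℕk≡i ⟩
      ((b ∷ u) ++ω repeat b u) i              ∎
    where
    open ≡-Reasoning
    k = i mod suc (length u)
    toℕk≡i : toℕ k ≡ i
    toℕk≡i = trans (toℕ-fromℕ< (m%n<n i (suc (length u)))) (m<n⇒m%n≡m i<l)
  ... | no i≮l with m≤n⇒∃[o]m+o≡n (≮⇒≥ i≮l)
  ...   | o , refl = begin
      lookup (b ∷ u) ((l + o) mod l)          ≡⟨ cong (lookup (b ∷ u)) periodic ⟩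
      repeat b u o                            ≡⟨ shift-++ω (b ∷ u) o ⟨
      ((b ∷ u) ++ω repeat b u) (l + o)        ∎
    where
    open ≡-Reasoning
    l = suc (length u)
    periodic : (l + o) mod l ≡ o mod l
    periodic = toℕ-injective (begin
      toℕ ((l + o) mod l)  ≡⟨ toℕ-fromℕ< (m%n<n (l + o) l) ⟩
      (l + o) % l          ≡⟨ cong (_% l) (+-comm l o) ⟩
      (o + l) % l          ≡⟨ [m+n]%n≡m%n o l ⟩
      o % l                ≡⟨ toℕ-fromℕ< (m%n<n o l) ⟨
      toℕ (o mod l)        ∎)

-- The generalized order on infinite words

module Order {a ℓ} (em : ExcludedMiddle (a ⊔ ℓ)) {A : Set a}
  (lt : ℕ → Rel A ℓ) (sto : ∀ n → IsStrictTotalOrder _≡_ (lt n)) where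

  private module STO n = IsStrictTotalOrder (sto n)

  lt-irrefl : ∀ {n b c} → b ≡ c → ¬ lt n b c
  lt-irrefl {n} = STO.irrefl n

  infix 4 _≺_ _≼_

  FirstDiffAt : ℕ → Rel (ℕ → A) (a ⊔ ℓ)
  FirstDiffAt n x y = Agree n x y × lt n (x n) (y n)

  -- With `_≼_` as the negated converse, weak forms of the comparison lemmas are contrapositives of
  -- strict ones; `≺-compare` recovers the disjunction.
  _≺_ _≼_ : Rel (ℕ → A) (a ⊔ ℓ)
  x ≺ y = ∃ λ n → FirstDiffAt n x y
  x ≼ y = ¬ (y ≺ x)

  -- A comparison decided at position `m` reads only `m + 1` letters of each word.
  FirstDiffAt-resp : ∀ {m n x x′ y y′} → m < n → Agree n x x′ → Agree n y y′ →
                     FirstDiffAt m x y → FirstDiffAt m x′ y′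
  FirstDiffAt-resp {m} m<n ex ey (e , l) =
    Agree-trans (Agree-sym (Agree-weaken (<⇒≤ m<n) ex)) (Agree-trans e (Agree-weaken (<⇒≤ m<n) ey)) ,
    subst₂ (lt m) (ex m m<n) (ey m m<n) l

  ≺-resp : ∀ {x x′ y y′} → x ≗ x′ → y ≗ y′ → x ≺ y → x′ ≺ y′
  ≺-resp ex ey (n , d) = n , FirstDiffAt-resp (n<1+n n) (≗⇒Agree ex) (≗⇒Agree ey) d

  ≼-resp : ∀ {x x′ y y′} → x ≗ x′ → y ≗ y′ → x ≼ y → x′ ≼ y′
  ≼-resp ex ey x≼y y≺x = x≼y (≺-resp (≗-sym ey) (≗-sym ex) y≺x)

  ≺-irrefl : ∀ {x y} → x ≗ y → ¬ x ≺ y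
  ≺-irrefl e (n , _ , l) = lt-irrefl (e n) l

  ≺-trans : ∀ {x y z} → x ≺ y → y ≺ z → x ≺ z
  ≺-trans {x} {y} {z} (m , e , l) (n , f , l′) with <-cmp m n
  ... | tri< m<n _ _ = m , Agree-trans e (Agree-weaken (<⇒≤ m<n) f) , subst (lt m (x m)) (f m m<n) l
  ... | tri≈ _ refl _ = m , Agree-trans e f , STO.trans m l l′
  ... | tri> _ _ n<m = n , Agree-trans (Agree-weaken (<⇒≤ n<m) e) f , subst (λ b → lt n b (z n)) (sym (e n n<m)) l′

  ≺-compare : ∀ x y → x ≺ y ⊎ x ≗ y ⊎ y ≺ x
  ≺-compare x y with em {x ≺ y} | em {y ≺ x}
  ... | yes x≺y | _       = inj₁ x≺y
  ... | no _    | yes y≺x = inj₂ (inj₂ y≺x)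
  ... | no x⊀y  | no y⊀x  = inj₂ (inj₁ (<-rec (λ n → x n ≡ y n) step))
    where
    step : ∀ n → (∀ {i} → i < n → x i ≡ y i) → x n ≡ y n
    step n e with STO.compare n (x n) (y n)
    ... | tri< l _ _ = contradiction (n , (λ _ → e) , l) x⊀y
    ... | tri≈ _ eq _ = eq
    ... | tri> _ _ l = contradiction (n , (λ _ i<n → sym (e i<n)) , l) y⊀x

  ≺⇒≼ : ∀ {x y} → x ≺ y → x ≼ y
  ≺⇒≼ x≺y y≺x = ≺-irrefl (λ _ → refl) (≺-trans x≺y y≺x)

  ≗⇒≼ : ∀ {x y} → x ≗ y → x ≼ y
  ≗⇒≼ e = ≺-irrefl (≗-sym e)

  ≼-split : ∀ {x y} → x ≼ y → x ≺ y ⊎ x ≗ y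
  ≼-split {x} {y} x≼y with ≺-compare x y
  ... | inj₁ l = inj₁ l
  ... | inj₂ (inj₁ e) = inj₂ e
  ... | inj₂ (inj₂ g) = contradiction g x≼y

  ≼-≺-trans : ∀ {x y z} → x ≼ y → y ≺ z → x ≺ z
  ≼-≺-trans x≼y y≺z with ≼-split x≼y
  ... | inj₁ x≺y = ≺-trans x≺y y≺z
  ... | inj₂ x≗y = ≺-resp (≗-sym x≗y) (λ _ → refl) y≺z

  ≺-≼-trans : ∀ {x y z} → x ≺ y → y ≼ z → x ≺ z
  ≺-≼-trans x≺y y≼z with ≼-split y≼z
  ... | inj₁ y≺z = ≺-trans x≺y y≺z
  ... | inj₂ y≗z = ≺-resp (λ _ → refl) y≗z x≺y

  ≼-trans : ∀ {x y z} → x ≼ y → y ≼ z → x ≼ z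
  ≼-trans x≼y y≼z z≺x = y≼z (≺-≼-trans z≺x x≼y)

  ≼-antisym : ∀ {x y} → x ≼ y → y ≼ x → x ≗ y
  ≼-antisym x≼y y≼x with ≼-split x≼y
  ... | inj₁ x≺y = contradiction x≺y y≼x
  ... | inj₂ x≗y = x≗y

  -- If `x` fell below `y` at some position before `n`, the same difference would put `z` below
  -- `y′`.
  sandwich : ∀ {n x y y′ z} → x ≼ y → Agree n y y′ → y′ ≼ z → Agree n x z → Agree n x y
  sandwich {n} {x} {y} {y′} {z} x≼y f y′≼z e with ≼-split x≼y
  ... | inj₂ x≗y = ≗⇒Agree x≗y
  ... | inj₁ (j , d) with j <? n
  ...   | yes j<n = contradiction (j , FirstDiffAt-resp j<n e f d) y′≼z
  ...   | no j≮n = Agree-weaken (≮⇒≥ j≮n) (proj₁ d)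

  -- Comparison with infinite powers

  module Powers (w : ℕ → A) where

    -- The value at [] is never used.
    pow : List A → (ℕ → A)
    pow []      = w
    pow (b ∷ u) = repeat b u

    pow-unfold : ∀ {u} → u ≢ [] → pow u ≗ u ++ω pow u
    pow-unfold {[]}    u≢[] = contradiction refl u≢[]
    pow-unfold {b ∷ u} _    = repeat-unfold b u

    length>0 : ∀ {u : List A} → u ≢ [] → 0 < length u
    length>0 {[]}    u≢[] = contradiction refl u≢[]
    length>0 {b ∷ u} _    = z<s

    -- If x and uuu⋯ first differ at n, then ux and uuu⋯ agree beyond n, so x
    -- compares with ux as it does with uuu⋯.
    private
      prepend-Agree : ∀ {u n x} → u ≢ [] → Agree n x (pow u) → Agree (suc n) (u ++ω x) (pow u)
      prepend-Agree {u} {n} u≢[] e =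
        Agree-weaken (+-monoˡ-≤ n (length>0 u≢[]))
          (Agree-trans (++ω-Agree u e) (≗⇒Agree (≗-sym (pow-unfold u≢[]))))

    ≺pow⇒≺++ : ∀ {u x} → u ≢ [] → x ≺ pow u → x ≺ u ++ω x
    ≺pow⇒≺++ u≢[] (n , d) =
      n , FirstDiffAt-resp (n<1+n n) (λ _ _ → refl) (Agree-sym (prepend-Agree u≢[] (proj₁ d))) d

    pow≺⇒++≺ : ∀ {u x} → u ≢ [] → pow u ≺ x → u ++ω x ≺ x
    pow≺⇒++≺ u≢[] (n , d) =
      n , FirstDiffAt-resp (n<1+n n) (Agree-sym (prepend-Agree u≢[] (Agree-sym (proj₁ d)))) (λ _ _ → refl) d

    ≗pow⇒≗++ : ∀ {u x} → u ≢ [] → x ≗ pow u → x ≗ u ++ω x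
    ≗pow⇒≗++ {u} u≢[] e = ≗-trans e (≗-trans (pow-unfold u≢[]) (++ω-congʳ u (≗-sym e)))

    pow≼⇒++≼ : ∀ {u x} → u ≢ [] → pow u ≼ x → u ++ω x ≼ x
    pow≼⇒++≼ u≢[] p with ≼-split p
    ... | inj₁ l = ≺⇒≼ (pow≺⇒++≺ u≢[] l)
    ... | inj₂ e = ≗⇒≼ (≗-sym (≗pow⇒≗++ u≢[] (≗-sym e)))

    ≼pow⇒≼++ : ∀ {u x} → u ≢ [] → x ≼ pow u → x ≼ u ++ω x
    ≼pow⇒≼++ u≢[] p with ≼-split p
    ... | inj₁ l = ≺⇒≼ (≺pow⇒≺++ u≢[] l)
    ... | inj₂ e = ≗⇒≼ (≗pow⇒≗++ u≢[] e)

    -- The converses hold by contraposition: if `x ≺ pow u` fails, then `pow u ≼ x`, hence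
    -- `u ++ω x ≼ x`.
    ≺++⇒≺pow : ∀ {u x} → u ≢ [] → x ≺ u ++ω x → x ≺ pow u
    ≺++⇒≺pow {u} {x} u≢[] l = case em {x ≺ pow u} of λ
      { (yes p) → p ; (no ¬p) → contradiction l (pow≼⇒++≼ u≢[] ¬p) }

    ++≺⇒pow≺ : ∀ {u x} → u ≢ [] → u ++ω x ≺ x → pow u ≺ x
    ++≺⇒pow≺ {u} {x} u≢[] l = case em {pow u ≺ x} of λ
      { (yes p) → p ; (no ¬p) → contradiction l (≼pow⇒≼++ u≢[] ¬p) }

    ++≼⇒pow≼ : ∀ {u x} → u ≢ [] → u ++ω x ≼ x → pow u ≼ x
    ++≼⇒pow≼ u≢[] l p = l (≺pow⇒≺++ u≢[] p)

    ≼++⇒≼pow : ∀ {u x} → u ≢ [] → x ≼ u ++ω x → x ≼ pow u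
    ≼++⇒≼pow u≢[] l p = l (pow≺⇒++≺ u≢[] p)

    ≗++⇒≗pow : ∀ {u x} → u ≢ [] → x ≗ u ++ω x → x ≗ pow u
    ≗++⇒≗pow u≢[] e = ≼-antisym (≼++⇒≼pow u≢[] (≗⇒≼ e)) (++≼⇒pow≼ u≢[] (≗⇒≼ (≗-sym e)))

    ++≢[]ˡ : ∀ {u v : List A} → u ≢ [] → u ++ v ≢ []
    ++≢[]ˡ {[]}    u≢[] _ = u≢[] refl
    ++≢[]ˡ {b ∷ u} _    ()

    private
      pow-absorb : ∀ u {v} → v ≢ [] → (u ++ v) ++ω pow v ≗ u ++ω pow v
      pow-absorb u {v} v≢[] = ≗-trans (++ω-assoc u v) (++ω-congʳ u (≗-sym (pow-unfold v≢[])))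

    -- Because (uv)v^ω = uv^ω, testing uv or u against v^ω is the same comparison of uv^ω with v^ω.
    pow-≺⇒pow-++-≺ : ∀ {u v} → u ≢ [] → v ≢ [] → pow u ≺ pow v → pow (u ++ v) ≺ pow v
    pow-≺⇒pow-++-≺ {u} u≢[] v≢[] l = ++≺⇒pow≺ (++≢[]ˡ u≢[])
      (≺-resp (≗-sym (pow-absorb u v≢[])) (λ _ → refl) (pow≺⇒++≺ u≢[] l))

    pow-++-≺⇒pow-≺ : ∀ {u v} → u ≢ [] → v ≢ [] → pow (u ++ v) ≺ pow v → pow u ≺ pow v
    pow-++-≺⇒pow-≺ {u} u≢[] v≢[] l = ++≺⇒pow≺ u≢[]
      (≺-resp (pow-absorb u v≢[]) (λ _ → refl) (pow≺⇒++≺ (++≢[]ˡ u≢[]) l))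

    -- If uv = vu, then u(uv)^ω is fixed under prepending uv, so it equals (uv)^ω. Thus (uv)^ω is
    -- fixed under prepending u, so it is u^ω, and by symmetry v^ω.
    commute⇒pow-≗ : ∀ {u v} → u ≢ [] → v ≢ [] → u ++ v ≡ v ++ u → pow u ≗ pow v
    commute⇒pow-≗ {u} {v} u≢[] v≢[] uv≡vu = ≗-trans (≗-sym (fixed u≢[] uv≡vu))
      (≗-trans (λ i → cong (λ s → pow s i) uv≡vu) (fixed v≢[] (sym uv≡vu)))
      where
      fixed : ∀ {u v} → u ≢ [] → u ++ v ≡ v ++ u → pow (u ++ v) ≗ pow u
      fixed {u} {v} u≢[] eq = ≗++⇒≗pow u≢[] (≗-sym (≗++⇒≗pow uv≢[] unfolded))
        where
        uv≢[] = ++≢[]ˡ {u} {v} u≢[]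
        unfolded : u ++ω pow (u ++ v) ≗ (u ++ v) ++ω (u ++ω pow (u ++ v))
        unfolded = ≗-trans (++ω-congʳ u (pow-unfold uv≢[]))
          (≗-trans (λ i → cong (λ s → (u ++ω (s ++ω pow (u ++ v))) i) eq)
          (≗-trans (++ω-congʳ u (++ω-assoc v u)) (≗-sym (++ω-assoc u v))))

    -- The word (uv)v^ω = uv^ω follows u^ω past the first difference, and (vu)u^ω follows v^ω
    -- likewise, so the difference is unchanged. It lies within |uv| letters, as otherwise uv = vu
    -- and the powers coincide; hence the tails are arbitrary.
    ≺⇒first-diff : ∀ {u v} → u ≢ [] → v ≢ [] → pow u ≺ pow v →
                   ∃ λ n → n < length (u ++ v) × (∀ {x y} → FirstDiffAt n ((u ++ v) ++ω x) ((v ++ u) ++ω y))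
    ≺⇒first-diff {u} {v} u≢[] v≢[] (n , d@(e , l)) = n , n<uv , λ {x} {y} →
        FirstDiffAt-resp n<uv (++ω-prefix (u ++ v)) (Agree-weaken (≤-reflexive (sym |vu|≡|uv|)) (++ω-prefix (v ++ u))) d′
      where
      |vu|≡|uv| : length (v ++ u) ≡ length (u ++ v)
      |vu|≡|uv| = length-++-comm v u
      extend : ∀ {u v} → u ≢ [] → v ≢ [] → Agree n (pow u) (pow v) →
               Agree (suc n) (pow u) ((u ++ v) ++ω pow v)
      extend {u} u≢[] v≢[] e = Agree-trans (Agree-sym (prepend-Agree u≢[] (Agree-sym e)))
        (≗⇒Agree (≗-sym (pow-absorb u v≢[])))
      d′ : FirstDiffAt n ((u ++ v) ++ω pow v) ((v ++ u) ++ω pow u)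
      d′ = FirstDiffAt-resp (n<1+n n) (extend u≢[] v≢[] e) (extend v≢[] u≢[] (Agree-sym e)) d
      n<uv : n < length (u ++ v)
      n<uv with n <? length (u ++ v)
      ... | yes p = p
      ... | no ¬p = contradiction (n , d) (≺-irrefl (commute⇒pow-≗ u≢[] v≢[] (begin
          u ++ v                                                 ≡⟨ applyUpTo-prefix (u ++ v) _ ⟨
          applyUpTo ((u ++ v) ++ω pow v) (length (u ++ v))       ≡⟨ applyUpTo-cong _ (Agree-weaken (≮⇒≥ ¬p) (proj₁ d′)) ⟩
          applyUpTo ((v ++ u) ++ω pow u) (length (u ++ v))       ≡⟨ cong (applyUpTo _) |vu|≡|uv| ⟨
          applyUpTo ((v ++ u) ++ω pow u) (length (v ++ u))       ≡⟨ applyUpTo-prefix (v ++ u) _ ⟩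
          v ++ u                                                 ∎)))
        where open ≡-Reasoning

    first-diff⇒≺ : ∀ {u v} → u ≢ [] → v ≢ [] → (∀ {x y} → (u ++ v) ++ω x ≺ (v ++ u) ++ω y) → pow u ≺ pow v
    first-diff⇒≺ {u} {v} u≢[] v≢[] l with ≺-compare (pow u) (pow v)
    ... | inj₁ p = p
    ... | inj₂ (inj₂ p) = let n , _ , d = ≺⇒first-diff v≢[] u≢[] p in
      contradiction (l {w} {w}) (≺⇒≼ (n , d))
    -- If the powers are equal, the tails v^ω and u^ω turn both sides into that common power.
    ... | inj₂ (inj₁ e) = contradiction (l {pow v} {pow u})
      (≺-irrefl (≗-trans (unfold v≢[] u≢[] (≗-sym e)) (≗-trans e (≗-sym (unfold u≢[] v≢[] e)))))
      where
      unfold : ∀ {u v} → u ≢ [] → v ≢ [] → pow u ≗ pow v → (v ++ u) ++ω pow u ≗ pow v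
      unfold {u} {v} u≢[] v≢[] e = ≗-trans (pow-absorb v u≢[])
        (≗-trans (++ω-congʳ v e) (≗-sym (pow-unfold v≢[])))

  -- Cuts, factors and suffixes of a fixed infinite word

  module Cuts (w : ℕ → A) where

    open Powers w

    suffix : ℕ → (ℕ → A)
    suffix k = shift k w

    slice : ℕ → ℕ → List A
    slice k n = applyUpTo (suffix k) (n ∸ k)

    Ω : ℕ → ℕ → (ℕ → A)
    Ω k n = pow (slice k n)

    length-slice : ∀ k n → length (slice k n) ≡ n ∸ k
    length-slice k n = length-applyUpTo (suffix k) (n ∸ k)

    slice≢[] : ∀ {k n} → k < n → slice k n ≢ []
    slice≢[] {k} {n} k<n eq = <-irrefl (trans (cong length (sym eq)) (length-slice k n)) (m<n⇒0<n∸m k<n)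

    shift-suffix : ∀ {k m} → k ≤ m → shift (m ∸ k) (suffix k) ≗ suffix m
    shift-suffix {k} {m} k≤m i = cong w (trans (sym (+-assoc k (m ∸ k) i)) (cong (_+ i) (m+[n∸m]≡n k≤m)))

    ∸-telescope : ∀ {k m n} → k ≤ m → m ≤ n → (m ∸ k) + (n ∸ m) ≡ n ∸ k
    ∸-telescope {k} {m} {n} k≤m m≤n = begin
      (m ∸ k) + (n ∸ m) ≡⟨ +-comm (m ∸ k) (n ∸ m) ⟩
      (n ∸ m) + (m ∸ k) ≡⟨ +-∸-assoc (n ∸ m) k≤m ⟨
      ((n ∸ m) + m) ∸ k ≡⟨ cong (_∸ k) (m∸n+n≡m m≤n) ⟩
      n ∸ k             ∎
      where open ≡-Reasoning

    slice-++ : ∀ {k m n} → k ≤ m → m ≤ n → slice k m ++ slice m n ≡ slice k n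
    slice-++ {k} {m} {n} k≤m m≤n = begin
      slice k m ++ slice m n
        ≡⟨ cong (slice k m ++_) (applyUpTo-cong (n ∸ m) (≗⇒Agree (shift-suffix k≤m))) ⟨
      slice k m ++ applyUpTo (shift (m ∸ k) (suffix k)) (n ∸ m)
        ≡⟨ applyUpTo-+ (suffix k) (m ∸ k) (n ∸ m) ⟨
      applyUpTo (suffix k) ((m ∸ k) + (n ∸ m))
        ≡⟨ cong (applyUpTo (suffix k)) (∸-telescope k≤m m≤n) ⟩
      slice k n ∎
      where open ≡-Reasoning

    slice-++ω : ∀ {k n} → k ≤ n → slice k n ++ω suffix n ≗ suffix k
    slice-++ω {k} {n} k≤n = ≗-trans (++ω-congʳ (slice k n) (≗-sym (shift-suffix k≤n)))
      (applyUpTo-++ω (suffix k) (n ∸ k))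

    slice-Agree : ∀ {k n l x} → k ≤ n → Agree l x (suffix n) →
                  Agree ((n ∸ k) + l) (slice k n ++ω x) (suffix k)
    slice-Agree {k} {n} {l} k≤n e = Agree-trans
      (Agree-weaken (≤-reflexive (cong (_+ l) (sym (length-slice k n)))) (++ω-Agree (slice k n) e))
      (≗⇒Agree (slice-++ω k≤n))

    Ω-unfold : ∀ {k n} → k < n → Ω k n ≗ slice k n ++ω Ω k n
    Ω-unfold k<n = pow-unfold (slice≢[] k<n)

    Ω-prefix : ∀ {k n} → k < n → Agree (n ∸ k) (Ω k n) (suffix k)
    Ω-prefix {k} {n} k<n = Agree-trans (≗⇒Agree (Ω-unfold k<n))
      (Agree-weaken (m≤m+n (n ∸ k) 0) (slice-Agree {l = 0} (<⇒≤ k<n) λ _ ()))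

    module _ {k m n} (k<m : k < m) (m<n : m < n) where

      private
        split : slice k m ++ slice m n ≡ slice k n
        split = slice-++ (<⇒≤ k<m) (<⇒≤ m<n)

      Ω-≺-extend : Ω k m ≺ Ω m n → Ω k n ≺ Ω m n
      Ω-≺-extend l = subst (λ s → pow s ≺ Ω m n) split (pow-≺⇒pow-++-≺ (slice≢[] k<m) (slice≢[] m<n) l)

      Ω-≺-restrict : Ω k n ≺ Ω m n → Ω k m ≺ Ω m n
      Ω-≺-restrict l = pow-++-≺⇒pow-≺ (slice≢[] k<m) (slice≢[] m<n) (subst (λ s → pow s ≺ Ω m n) (sym split) l)

      Ω-≼-extend : Ω m n ≼ Ω k m → Ω m n ≼ Ω k n
      Ω-≼-extend p l = p (Ω-≺-restrict l)

      Ω-≼-restrict : Ω m n ≼ Ω k n → Ω m n ≼ Ω k m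
      Ω-≼-restrict p l = p (Ω-≺-extend l)

    module _ {k n} (k<n : k < n) where

      private
        split : slice k n ++ω suffix n ≗ suffix k
        split = slice-++ω (<⇒≤ k<n)

      -- Prepending w[k,n) to w_n gives w_k, so the criteria for powers become comparisons of
      -- suffixes.
      Ω≺⇒suffix≺ : Ω k n ≺ suffix n → suffix k ≺ suffix n
      Ω≺⇒suffix≺ l = ≺-resp split (λ _ → refl) (pow≺⇒++≺ (slice≢[] k<n) l)

      suffix≺⇒Ω≺ : suffix k ≺ suffix n → Ω k n ≺ suffix n
      suffix≺⇒Ω≺ l = ++≺⇒pow≺ (slice≢[] k<n) (≺-resp (≗-sym split) (λ _ → refl) l)

      ≼Ω⇒≼suffix : suffix n ≼ Ω k n → suffix n ≼ suffix k
      ≼Ω⇒≼suffix p l = p (suffix≺⇒Ω≺ l)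

      ≼suffix⇒≼Ω : suffix n ≼ suffix k → suffix n ≼ Ω k n
      ≼suffix⇒≼Ω p l = p (Ω≺⇒suffix≺ l)

      ≗suffix⇒≗Ω : suffix n ≗ suffix k → suffix n ≗ Ω k n
      ≗suffix⇒≗Ω e = ≗++⇒≗pow (slice≢[] k<n) (≗-trans e (≗-sym split))

      ≺suffix⇒≺Ω : suffix n ≺ suffix k → suffix n ≺ Ω k n
      ≺suffix⇒≺Ω l = ≺++⇒≺pow (slice≢[] k<n) (≺-resp (λ _ → refl) (≗-sym split) l)

    -- m ⇢ n says that w[m,n) is the last factor of the nonincreasing Lyndon
    -- factorization of the prefix w[0,n).
    infix 4 _⇢_

    record _⇢_ (m n : ℕ) : Set (a ⊔ ℓ) where
      field
        m<n    : m < n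
        bound  : ∀ {k} → k < m → Ω m n ≼ Ω k m
        lyndon : ∀ {k} → m < k → k < n → Ω m n ≺ Ω k n

      -- By `Ω-≼-extend`, the factors in `bound` may end at `n` instead of `m`. With `lyndon`, this
      -- makes `m` the last minimum of `Ω k n` over `k < n`.
      minimal : ∀ {k} → k < n → Ω m n ≼ Ω k n
      minimal {k} k<n with <-cmp k m
      ... | tri< k<m _ _  = Ω-≼-extend k<m m<n (bound k<m)
      ... | tri≈ _ refl _ = ≗⇒≼ λ _ → refl
      ... | tri> _ _ m<k  = ≺⇒≼ (lyndon m<k k<n)

      lyndon′ : ∀ {k} → m < k → k < n → Ω m k ≺ Ω k n
      lyndon′ m<k k<n = Ω-≺-restrict m<k k<n (lyndon m<k k<n)

    open _⇢_

    ⇢-unique : ∀ {l m n} → l ⇢ n → m ⇢ n → l ≡ m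
    ⇢-unique {l} {m} s t with <-cmp l m
    ... | tri< l<m _ _ = contradiction (lyndon s l<m (m<n t)) (minimal t (m<n s))
    ... | tri≈ _ eq _  = eq
    ... | tri> _ _ m<l = contradiction (lyndon t m<l (m<n s)) (minimal s (m<n t))

    ⇢-nonincreasing : ∀ {l m n} → l ⇢ m → m ⇢ n → Ω m n ≼ Ω l m
    ⇢-nonincreasing s t = bound t (m<n s)

    ¬⇢0 : ∀ {m} → ¬ m ⇢ 0
    ¬⇢0 s = contradiction (m<n s) λ ()

    last-minimum : ∀ (f : ℕ → ℕ → A) n → 0 < n →
      ∃ λ m → m < n × (∀ {k} → k < n → f m ≼ f k) × (∀ {k} → m < k → k < n → f m ≺ f k)
    last-minimum f (suc zero) _ = 0 , z<s , (λ { z<s → ≗⇒≼ λ _ → refl }) , λ { {zero} () _ ; {suc k} _ (s≤s ()) }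
    last-minimum f (suc n@(suc _)) _ with last-minimum f n z<s
    ... | m , m<n , min , strict with ≺-compare (f m) (f n)
    ...   | inj₁ fm≺fn = m , m<n⇒m<1+n m<n , min′ , strict′
      where
      min′ : ∀ {k} → k < suc n → f m ≼ f k
      min′ k<1+n with m<1+n⇒m<n∨m≡n k<1+n
      ... | inj₁ k<n  = min k<n
      ... | inj₂ refl = ≺⇒≼ fm≺fn
      strict′ : ∀ {k} → m < k → k < suc n → f m ≺ f k
      strict′ m<k k<1+n with m<1+n⇒m<n∨m≡n k<1+n
      ... | inj₁ k<n  = strict m<k k<n
      ... | inj₂ refl = fm≺fn
    -- A tie moves to the new index, so the minimum found is the last one.
    ...   | inj₂ fm≽fn = n , n<1+n n , min′ , λ n<k k<1+n → contradiction k<1+n (≤⇒≯ n<k)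
      where
      fn≼fm : f n ≼ f m
      fn≼fm = [ (λ e → ≗⇒≼ (≗-sym e)) , ≺⇒≼ ]′ fm≽fn
      min′ : ∀ {k} → k < suc n → f n ≼ f k
      min′ k<1+n with m<1+n⇒m<n∨m≡n k<1+n
      ... | inj₁ k<n  = ≼-trans fn≼fm (min k<n)
      ... | inj₂ refl = ≗⇒≼ λ _ → refl

    ⇢-exists : ∀ {n} → 0 < n → ∃ λ m → m ⇢ n
    ⇢-exists {n} 0<n with last-minimum (λ k → Ω k n) n 0<n
    ... | m , m<n , min , strict = m , record
      { m<n = m<n
      ; bound = λ k<m → Ω-≼-restrict k<m m<n (min (<-trans k<m m<n))
      ; lyndon = strict
      }

    infix 4 _⇢*_

    data _⇢*_ (m : ℕ) : ℕ → Set (a ⊔ ℓ) where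
      ε    : m ⇢* m
      _◅_  : ∀ {k n} → m ⇢ k → k ⇢* n → m ⇢* n

    ⇢*-snoc : ∀ {l m n} → l ⇢* m → m ⇢ n → l ⇢* n
    ⇢*-snoc ε        t = t ◅ ε
    ⇢*-snoc (s ◅ ss) t = s ◅ ⇢*-snoc ss t

    0⇢* : ∀ n → 0 ⇢* n
    0⇢* = <-rec (0 ⇢*_) step
      where
      step : ∀ n → (∀ {m} → m < n → 0 ⇢* m) → 0 ⇢* n
      step zero    rec = ε
      step (suc n) rec with ⇢-exists {suc n} z<s
      ... | m , s = ⇢*-snoc (rec (m<n s)) s

    MinimalSuffix : ℕ → Set (a ⊔ ℓ)
    MinimalSuffix m = ∀ k → suffix m ≼ suffix k

    record Path (c : ℕ → ℕ) : Set (a ⊔ ℓ) where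
      constructor mkPath
      field step : ∀ i → c i ⇢ c (suc i)

      step< : ∀ i → c i < c (suc i)
      step< i = m<n (step i)

      mono : ∀ {i j} → i ≤ j → c i ≤ c j
      mono {i} {j} i≤j with m≤n⇒m<n∨m≡n i≤j
      ... | inj₂ refl = ≤-refl
      mono {i} {suc j} _ | inj₁ (s≤s i≤j) = ≤-trans (mono i≤j) (<⇒≤ (step< j))

      mono< : ∀ {i j} → i < j → c i < c j
      mono< i<j = <-≤-trans (step< _) (mono i<j)

      grows : ∀ i → i ≤ c i
      grows zero    = z≤n
      grows (suc i) = ≤-<-trans (grows i) (step< i)

    open Path using (step; step<; mono; mono<; grows)

    -- Existence of a minimal suffix or an infinite path

    Frequently : (ℕ → Set (a ⊔ ℓ)) → Set (a ⊔ ℓ)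
    Frequently P = ∀ b → ∃ λ n → b ≤ n × P n

    -- Induction on the number of values: either `b` itself recurs, or it stops at some `B`, and
    -- from there on only smaller values occur.
    infinite-pigeonhole : ∀ b (P : ℕ → ℕ → Set (a ⊔ ℓ)) →
      Frequently (λ n → ∃ λ m → m < b × P m n) → ∃ λ m → m < b × Frequently (P m)
    infinite-pigeonhole zero P freq with freq 0
    ... | _ , _ , _ , () , _
    infinite-pigeonhole (suc b) P freq with em {Frequently (P b)} | em {∃ λ B → ∀ n → B ≤ n → ¬ P b n}
    ... | yes fb | _ = b , n<1+n b , fb
    ... | no ¬fb | no ¬ex = contradiction
            (λ B → case em {∃ λ n → B ≤ n × P b n} of λ
              { (yes p) → p
              ; (no ¬p) → contradiction (B , λ n B≤n p → ¬p (n , B≤n , p)) ¬ex }) ¬fb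
    ... | no ¬fb | yes (B , none) with infinite-pigeonhole b P freq′
      where
      freq′ : Frequently (λ n → ∃ λ m → m < b × P m n)
      freq′ B′ with freq (B ⊔ℕ B′)
      ... | n , le , m , m<1+b , p with m<1+n⇒m<n∨m≡n m<1+b
      ...   | inj₁ m<b  = n , ≤-trans (m≤n⊔m B B′) le , m , m<b , p
      ...   | inj₂ refl = contradiction p (none n (≤-trans (m≤m⊔n B B′) le))
    ...   | m , m<b , f = m , m<n⇒m<1+n m<b , f

    -- `S` is an invariant under which a branch can always be continued.
    path-through : ∀ {S : ℕ → Set (a ⊔ ℓ)} → S 0 → (∀ n → S n → ∃ λ n′ → n ⇢ n′ × S n′) →
                   ∃ λ c → c 0 ≡ 0 × Path c
    path-through {S} s₀ next = proj₁ ∘ state , refl , mkPath λ i → proj₁ (proj₂ (next _ (proj₂ (state i))))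
      where
      state : ℕ → ∃ S
      state zero    = 0 , s₀
      state (suc i) = let n′ , _ , s′ = next _ (proj₂ (state i)) in n′ , s′

    -- These are the possible infinite last factors: strictness after `m` is the Lyndon condition,
    -- and minimality against earlier suffixes is the nonincreasing one.
    StrictlyMinimalSuffix : ℕ → Set (a ⊔ ℓ)
    StrictlyMinimalSuffix m = MinimalSuffix m × (∀ {k} → m < k → suffix m ≺ suffix k)

    least : ∀ (P : ℕ → Set (a ⊔ ℓ)) {n} → P n → ∃ λ m → P m × (∀ {k} → k < m → ¬ P k)
    least P {n} = <-rec (λ n → P n → ∃ λ m → P m × (∀ {k} → k < m → ¬ P k)) go n
      where
      go : ∀ n → (∀ {m} → m < n → P m → ∃ λ m → P m × (∀ {k} → k < m → ¬ P k)) →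
           P n → ∃ λ m → P m × (∀ {k} → k < m → ¬ P k)
      go n rec p with em {∃ λ k → k < n × P k}
      ... | yes (k , k<n , q) = rec k<n q
      ... | no none           = n , p , λ k<n q → none (_ , k<n , q)

    -- At the first return `n` of the minimal suffix, w_n = w_m = w[m,n)^ω, so both conditions for
    -- `m ⇢ n` compare this suffix with others. Firstness makes the comparisons between `m` and `n`
    -- strict.
    recurrence-⇢ : (∀ {m} → ¬ StrictlyMinimalSuffix m) → ∀ {m} → MinimalSuffix m →
                   ∃ λ n → m ⇢ n × MinimalSuffix n
    recurrence-⇢ none {m} min with em {∃ λ k → m < k × suffix k ≼ suffix m}
    ... | no ¬ex = contradiction
            (min , λ {k} m<k → case em {suffix m ≺ suffix k} of λ
              { (yes p) → p ; (no ¬p) → contradiction (k , m<k , ¬p) ¬ex }) none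
    ... | yes (_ , ex) with least (λ k → m < k × suffix k ≼ suffix m) ex
    ...   | n , (m<n , wn≼wm) , first = n , m⇢n , λ k → ≼-trans wn≼wm (min k)
      where
      wn≗wm : suffix n ≗ suffix m
      wn≗wm = ≼-antisym wn≼wm (min n)
      wn≗Ω : suffix n ≗ Ω m n
      wn≗Ω = ≗suffix⇒≗Ω m<n wn≗wm
      wm≗Ω : suffix m ≗ Ω m n
      wm≗Ω = ≗-trans (≗-sym wn≗wm) wn≗Ω
      m⇢n : m ⇢ n
      m⇢n = record
        { m<n = m<n
        ; bound = λ k<m → ≼-resp wm≗Ω (λ _ → refl) (≼suffix⇒≼Ω k<m (min _))
        ; lyndon = λ {k} m<k k<n → ≺-resp wn≗Ω (λ _ → refl) (≺suffix⇒≺Ω k<n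
            (case em {suffix n ≺ suffix k} of λ
              { (yes p) → p
              ; (no ¬p) → contradiction (m<k , ≼-trans ¬p wn≼wm) (first k<n) }))
        }

    -- If w_k were smaller than w_m with first difference at `d`, a successor `n` of `m` so far away
    -- that w[k,n) and w[m,n) both have more than `d` letters would violate `minimal`.
    infinite-degree⇒minimal : ∀ {m} → Frequently (m ⇢_) → MinimalSuffix m
    infinite-degree⇒minimal {m} freq k (d , diff) with freq (suc ((m + k) + suc d))
    ... | n , big , m⇢n = minimal m⇢n k<n (d , FirstDiffAt-resp (n<1+n d)
            (agree (m≤n+m k m) k<n) (agree (m≤m+n m k) (m<n m⇢n)) diff)
      where
      far : ∀ {j} → j ≤ m + k → j + suc d < n
      far j≤ = ≤-trans (s≤s (+-monoˡ-≤ (suc d) j≤)) big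
      k<n : k < n
      k<n = ≤-<-trans (m≤m+n k (suc d)) (far (m≤n+m k m))
      agree : ∀ {j} → j ≤ m + k → j < n → Agree (suc d) (suffix j) (Ω j n)
      agree {j} j≤m+k j<n = Agree-sym (Agree-weaken
        (m+n≤o⇒m≤o∸n (suc d) (subst (_≤ n) (+-comm j (suc d)) (<⇒≤ (far j≤m+k)))) (Ω-prefix j<n))

    ∃-path : ¬ (∃ StrictlyMinimalSuffix) → ∃ λ c → c 0 ≡ 0 × Path c
    ∃-path none with em {∃ MinimalSuffix}
    -- Invariant: some route leads from the node to a minimal suffix. When the route is used up, the
    -- next recurrence supplies an edge.
    ... | yes (m , min) = path-through {λ n → ∃ λ m → n ⇢* m × MinimalSuffix m} (m , 0⇢* m , min)
            (λ { _ (m , s ◅ ss , min) → _ , s , m , ss , min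
               ; _ (m , ε , min) → let n , s , min′ = recurrence-⇢ (λ p → none (_ , p)) min in n , s , n , ε , min′ })
    -- Invariant: infinitely many descendants. Successors are bounded here, so by pigeonhole one of
    -- them inherits it.
    ... | no ¬min = path-through {λ n → Frequently (n ⇢*_)} (λ b → b , ≤-refl , 0⇢* b) (λ _ → konig)
      where
      konig : ∀ {m} → Frequently (m ⇢*_) → ∃ λ n → m ⇢ n × Frequently (n ⇢*_)
      konig {m} freq with em {∃ λ B → ∀ n → B ≤ n → ¬ m ⇢ n}
      ... | no ¬bounded = contradiction (m , infinite-degree⇒minimal λ b →
              case em {∃ λ n → b ≤ n × m ⇢ n} of λ
                { (yes p) → p
                ; (no ¬p) → contradiction (b , λ n b≤n s → ¬p (n , b≤n , s)) ¬bounded }) ¬min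
      ... | yes (B , bounded) with infinite-pigeonhole B (λ k n → m ⇢ k × k ⇢* n) freq′
        where
        freq′ : Frequently (λ n → ∃ λ k → k < B × m ⇢ k × k ⇢* n)
        -- Asking for a descendant beyond `m` excludes `m` itself, so the route has a first edge.
        freq′ b with freq (b ⊔ℕ suc m)
        ... | n , le , ε = contradiction (≤-trans (m≤n⊔m b (suc m)) le) (<-irrefl refl)
        ... | n , le , _◅_ {k = k} s ss = n , ≤-trans (m≤m⊔n b (suc m)) le , k ,
                ≰⇒> (λ B≤k → bounded k B≤k s) , s , ss
      ...   | k , _ , fr with fr 0
      ...     | _ , _ , s , _ = k , s , λ b → let n , le , _ , ss = fr b in n , le , ss

    -- Uniqueness of infinite paths

    Path-drop : ∀ {c} m → Path c → Path (λ i → c (m + i))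
    Path-drop {c} m path = mkPath λ i → subst (λ j → c (m + i) ⇢ c j) (sym (+-suc m i)) (step path (m + i))

    locate : ∀ {c} → Path c → ∀ {i x} → c i < x → (∀ j → c j ≢ x) → ∃ λ j → i ≤ j × c j < x × x < c (suc j)
    locate {c} path {i} {x} ci<x ∉ = go x i (m≤m+n x i) ci<x
      where
      -- Since `i ≤ c i` along a path, the path passes `x` before the fuel runs out.
      go : ∀ fuel i → x ≤ fuel + i → c i < x → ∃ λ j → i ≤ j × c j < x × x < c (suc j)
      go zero i x≤i ci<x = contradiction (≤-<-trans (≤-trans x≤i (grows path i)) ci<x) (<-irrefl refl)
      go (suc fuel) i x≤ ci<x with <-cmp (c (suc i)) x
      ... | tri> _ _ x<c  = i , ≤-refl , ci<x , x<c
      ... | tri≈ _ c≡x _  = contradiction c≡x (∉ (suc i))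
      ... | tri< c<x _ _  = let j , i<j , r = go fuel (suc i) (subst (x ≤_) (sym (+-suc fuel i)) x≤) c<x in
                            j , <⇒≤ i<j , r

    module _ {c} (path : Path c) where

      private
        C W : ℕ → (ℕ → A)
        C j = Ω (c j) (c (suc j))
        W j = suffix (c j)
        len : ℕ → ℕ
        len j = c (suc j) ∸ c j

      Ω-antitone : ∀ {i j} → i ≤ j → C j ≼ C i
      Ω-antitone {i} {j} i≤j with m≤n⇒m<n∨m≡n i≤j
      ... | inj₂ refl = ≗⇒≼ λ _ → refl
      Ω-antitone {i} {suc j} _ | inj₁ (s≤s i≤j) =
        ≼-trans (⇢-nonincreasing (step path j) (step path (suc j))) (Ω-antitone i≤j)

      -- The words W j increase and the C j decrease below them, so all later blocks
      -- are prefixes of C 0 short enough not to see where it differs from W 1.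
      -- Hence C is eventually constant, and then equal to W.
      ¬Ω≺suffix : ¬ (∀ j → C j ≺ W (suc j))
      ¬Ω≺suffix C≺W = lt-irrefl (agrees (suc d₁) (<⇒≤ (n<1+n j₁)) d₁ (n<1+n d₁)) (proj₂ diff₁)
        where
        W-increasing : ∀ j → W j ≺ W (suc j)
        W-increasing j = Ω≺⇒suffix≺ (step< path j) (C≺W j)

        W-mono : ∀ {i j} → i ≤ j → W i ≼ W j
        W-mono {i} {j} i≤j with m≤n⇒m<n∨m≡n i≤j
        ... | inj₂ refl = ≗⇒≼ λ _ → refl
        W-mono {i} {suc j} _ | inj₁ (s≤s i≤j) = ≼-trans (W-mono i≤j) (≺⇒≼ (W-increasing j))

        d : ℕ
        d = proj₁ (C≺W 0)

        -- `C j ≼ C 0 ≼ W j`, and the outer words share the block of length `len j`.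
        block-prefix : ∀ {j} → 0 < j → Agree (len j) (C 0) (W j)
        block-prefix {j} 0<j = Agree-trans
          (Agree-sym (sandwich (Ω-antitone z≤n) (λ _ _ → refl)
            (≼-trans (≺⇒≼ (C≺W 0)) (W-mono 0<j)) (Ω-prefix (step< path j))))
          (Ω-prefix (step< path j))

        -- A longer block would make `C 0` and `W j` agree beyond `d`, and `W 1`, lying between
        -- them, would agree with `C 0` at `d`.
        len-bounded : ∀ {j} → 0 < j → len j < suc d
        len-bounded {j} 0<j with len j ≤? d
        ... | yes p = s≤s p
        ... | no ¬p = contradiction (proj₂ (proj₂ (C≺W 0)))
                (lt-irrefl (sandwich (≺⇒≼ (C≺W 0)) (λ _ _ → refl) (W-mono 0<j) (block-prefix 0<j) d (≰⇒> ¬p)))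

        recurring : ∃ λ l → l < suc d × Frequently (λ j → Lift (a ⊔ ℓ) (0 < j × len j ≡ l))
        recurring = infinite-pigeonhole (suc d) (λ l j → Lift (a ⊔ ℓ) (0 < j × len j ≡ l))
          λ b → suc b , n≤1+n b , len (suc b) , len-bounded z<s , lift (z<s , refl)

        l j₁ : ℕ
        l = proj₁ recurring
        j₁ = proj₁ (proj₂ (proj₂ recurring) 0)

        C≡ : ∀ {j} → 0 < j × len j ≡ l → C j ≡ pow (applyUpTo (C 0) l)
        C≡ {j} (0<j , eq) = cong pow
          (trans (sym (applyUpTo-cong (len j) (block-prefix 0<j))) (cong (applyUpTo (C 0)) eq))

        -- `j` lies between two indices whose blocks have the recurring length `l`. These blocks are
        -- the same prefix of `C 0`, so the antitone sequence is constant between them.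
        C-constant : ∀ {j} → j₁ ≤ j → C j ≗ C j₁
        C-constant {j} j₁≤j with proj₂ (proj₂ recurring) 0 | proj₂ (proj₂ recurring) j
        ... | _ , _ , lift at-j₁ | j₂ , j≤j₂ , lift at-j₂ = ≼-antisym (Ω-antitone j₁≤j)
                (≼-resp (λ i → cong (λ x → x i) (trans (C≡ at-j₂) (sym (C≡ at-j₁)))) (λ _ → refl) (Ω-antitone j≤j₂))

        -- Unfolding the constant power once matches one nonempty block of `w`, which gains at least
        -- one letter.
        agrees : ∀ n {j} → j₁ ≤ j → Agree n (C j₁) (W j)
        agrees zero    j₁≤j i ()
        agrees (suc n) {j} j₁≤j = Agree-trans
          (≗⇒Agree (≗-trans (≗-sym (C-constant j₁≤j)) (≗-trans (Ω-unfold (step< path j))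
            (++ω-congʳ (slice (c j) (c (suc j))) (C-constant j₁≤j)))))
          (Agree-weaken (+-monoˡ-≤ n (m<n⇒0<n∸m (step< path j)))
            (slice-Agree (<⇒≤ (step< path j)) (agrees n (m≤n⇒m≤1+n j₁≤j))))

        d₁ : ℕ
        d₁ = proj₁ (C≺W j₁)

        diff₁ : FirstDiffAt d₁ (C j₁) (W (suc j₁))
        diff₁ = proj₂ (C≺W j₁)

    -- For a cut beyond `m`, minimality bounds the power of the block ending there by that of the
    -- factor starting at `m`, which is below the suffix at the cut. `¬Ω≺suffix` forbids this for
    -- all blocks.
    path-excludes-Lyndon-suffix : ∀ {c m} → Path c → ¬ (∀ {k} → m < k → suffix m ≺ suffix k)
    path-excludes-Lyndon-suffix {c} {m} path lyn = ¬Ω≺suffix (Path-drop m path) λ j →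
      subst (λ i → Ω (c (m + j)) (c i) ≺ suffix (c i)) (sym (+-suc m j))
        (let m<c = ≤-<-trans (≤-trans (m≤m+n m j) (grows path (m + j))) (step< path (m + j)) in
         ≼-≺-trans (minimal (step path (m + j)) m<c) (suffix≺⇒Ω≺ m<c (lyn m<c)))

    -- With p = P i, q = Q (j + 1), p⁺ = P (i + 1), the overlapping factors w[Q j,q)
    -- and w[p,p⁺) are cut into α = w[s,p), u = w[p,q) and z = w[q,p⁺), where s is the
    -- preceding cut Q j or the preceding cut of P.
    record Crossing (P Q : ℕ → ℕ) : Set (a ⊔ ℓ) where
      field
        i j s   : ℕ
        q₀<p    : Q j < P i
        p<q     : P i < Q (suc j)
        q<p⁺    : Q (suc j) < P (suc i)
        q₀≤s    : Q j ≤ s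
        s<p     : s < P i
        start   : s ≡ Q j ⊎ s ⇢ P i

      width common : ℕ
      width   = P i ∸ s
      common = Q (suc j) ∸ P i

    open Crossing using (width; common)

    Disjoint : Rel (ℕ → ℕ) _
    Disjoint P Q = ∀ i j → P i ≢ Q j

    module _ {P Q} (pathP : Path P) (pathQ : Path Q) (disjoint : Disjoint P Q) (X : Crossing P Q) where
      open Crossing X hiding (width; common)

      private
        p p⁺ q₀ q n : ℕ
        p = P i
        p⁺ = P (suc i)
        q₀ = Q j
        q = Q (suc j)
        n = width X

        v D : ℕ → A
        v = suffix s
        D = Ω q₀ q

        p⇢p⁺ : p ⇢ p⁺
        p⇢p⁺ = step pathP i

        q₀⇢q : q₀ ⇢ q
        q₀⇢q = step pathQ j

        -- If `s` is `q₀`, this is the Lyndon property of w[q₀,q) at `p`. Otherwise `s` is the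
        -- minimum for `p`, and `Ω q₀ p` lies in between.
        Ωsp≺Ωpq : Ω s p ≺ Ω p q
        Ωsp≺Ωpq with start
        ... | inj₁ refl = lyndon′ q₀⇢q s<p p<q
        ... | inj₂ s⇢p  = ≼-≺-trans (minimal s⇢p q₀<p) (lyndon′ q₀⇢q q₀<p p<q)

        -- In the case `q₀ < s`, on the first `n` letters `Ω q₀ p` is `D` and `Ω s p` is `Ω s q`. As
        -- `Ω s p ≼ Ω q₀ p` and `D ≺ Ω s q`, all four agree there.
        D-prefix : Agree n D v
        D-prefix with m≤n⇒m<n∨m≡n q₀≤s
        ... | inj₂ refl = Agree-weaken (∸-monoˡ-≤ s (<⇒≤ p<q)) (Ω-prefix (<-trans q₀<p p<q))
        ... | inj₁ q₀<s with start
        ...   | inj₁ s≡q₀ = contradiction q₀<s (<-irrefl (sym s≡q₀))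
        ...   | inj₂ s⇢p = Agree-trans (Agree-sym Ωq₀p∼D) (Agree-trans (Agree-sym Ωsp∼Ωq₀p) (Ω-prefix s<p))
          where
          Ωq₀p∼D : Agree n (Ω q₀ p) D
          Ωq₀p∼D = Agree-weaken (∸-monoʳ-≤ p q₀≤s) (Agree-trans (Ω-prefix q₀<p)
            (Agree-sym (Agree-weaken (∸-monoˡ-≤ q₀ (<⇒≤ p<q)) (Ω-prefix (<-trans q₀<p p<q)))))
          Ωsp∼Ωsq : Agree n (Ω s p) (Ω s q)
          Ωsp∼Ωsq = Agree-trans (Ω-prefix s<p)
            (Agree-sym (Agree-weaken (∸-monoˡ-≤ s (<⇒≤ p<q)) (Ω-prefix (<-trans s<p p<q))))
          Ωsp∼Ωq₀p : Agree n (Ω s p) (Ω q₀ p)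
          Ωsp∼Ωq₀p = sandwich (minimal s⇢p q₀<p) Ωq₀p∼D
            (≺⇒≼ (lyndon q₀⇢q q₀<s (<-trans s<p p<q))) Ωsp∼Ωsq

        -- u^ω > α^ω gives αu < uα, and α^ω ≥ (uz)^ω gives αuz ≥ uzα; if z began
        -- with α, the second would contradict the first.
        tail-not-v : n ≤ p⁺ ∸ q → ¬ Agree n (suffix q) v
        tail-not-v n≤z e with ≺⇒first-diff (slice≢[] s<p) (slice≢[] p<q) Ωsp≺Ωpq
        ... | N , N< , diff = ≼pow⇒≼++ (slice≢[] s<p) (bound p⇢p⁺ s<p) (N ,
                FirstDiffAt-resp N<n+m left right (diff {suffix q} {suffix p}))
          where
          α u : List A
          α = slice s p
          u = slice p q
          N<n+m : N < n + (q ∸ p)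
          N<n+m = subst (N <_) (trans (length-++ α) (cong₂ _+_ (length-slice s p) (length-slice p q))) N<
          left : Agree (n + (q ∸ p)) ((α ++ u) ++ω suffix q) (α ++ω Ω p p⁺)
          left = Agree-trans
            (≗⇒Agree (≗-trans (++ω-assoc α u) (≗-trans (++ω-congʳ α (slice-++ω (<⇒≤ p<q))) (slice-++ω (<⇒≤ s<p)))))
            (Agree-sym (slice-Agree (<⇒≤ s<p)
              (Agree-weaken (∸-monoˡ-≤ p (<⇒≤ q<p⁺)) (Ω-prefix (m<n p⇢p⁺)))))
          right : Agree (n + (q ∸ p)) ((u ++ α) ++ω suffix p) (Ω p p⁺)
          right = Agree-trans
            (≗⇒Agree (≗-trans (++ω-assoc u α) (++ω-congʳ u (slice-++ω (<⇒≤ s<p)))))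
            (Agree-trans (Agree-weaken (≤-reflexive (+-comm n (q ∸ p))) (slice-Agree (<⇒≤ p<q) (Agree-sym e)))
              (Agree-sym (Agree-weaken fits (Ω-prefix (m<n p⇢p⁺)))))
            where
            fits : n + (q ∸ p) ≤ p⁺ ∸ p
            fits = ≤-trans (+-monoˡ-≤ (q ∸ p) n≤z) (≤-reflexive (trans (+-comm (p⁺ ∸ q) (q ∸ p))
              (∸-telescope (<⇒≤ p<q) (<⇒≤ q<p⁺))))

      private
        -- The invariant concerns the cuts `f` of `Q` in [q,p⁺). `pullback` carries an occurrence of
        -- α at `f` back to `q`, provided that the power of the block ending at `f` also begins with
        -- α.
        record Inv (k : ℕ) : Set (a ⊔ ℓ) where
          private
            f : ℕ
            f = Q (suc k)
          field
            f<p⁺     : f < p⁺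
            q≤f      : q ≤ f
            descends : Ω (Q k) f ≼ D
            below    : D ≺ Ω f p⁺
            pullback : Agree n (Ω (Q k) f) v → Agree n (suffix f) v → Agree n (suffix q) v

          p<f : p < f
          p<f = <-≤-trans p<q q≤f

        open Inv

        advance : ∀ {k} → j ≤ k → Q (suc k) < p⁺ → Inv k
        advance {k} j≤k k< with m≤n⇒m<n∨m≡n j≤k
        ... | inj₂ refl = record
          { f<p⁺     = q<p⁺
          ; q≤f      = ≤-refl
          ; descends = ≗⇒≼ λ _ → refl
          ; below    = ≼-≺-trans (minimal q₀⇢q p<q) (lyndon′ p⇢p⁺ p<q q<p⁺)
          ; pullback = λ _ e → e
          }
        advance {suc k} _ k< | inj₁ (s≤s j≤k) = record
          { f<p⁺     = k<
          ; q≤f      = ≤-trans (q≤f I) (<⇒≤ f<f′)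
          ; descends = ≼-trans smaller (descends I)
          -- `Ω f f′ ≼ Ω p f′ ≺ Ω f′ p⁺`, by minimality of `f` for `f′` and the Lyndon property of
          -- w[p,p⁺).
          ; below    = ≺-trans (below I) (Ω-≺-extend f<f′ k<
                         (≼-≺-trans (minimal f⇢f′ p<f′) (lyndon′ p⇢p⁺ p<f′ k<)))
          -- `Ω f f′` and `D` both begin with α, so `Ω (Q k) f` between them does too. As w_f′ also
          -- begins with α, w_f agrees with w[f,f′)^ω on `n` letters.
          ; pullback = λ e e′ → pullback I
              (Agree-trans (Agree-sym (sandwich smaller (λ _ _ → refl) (descends I)
                (Agree-trans e (Agree-sym D-prefix)))) e)
              (Agree-trans (pulled e e′) e)
          }
          where
          f f′ : ℕ
          f = Q (suc k)
          f′ = Q (suc (suc k))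
          f⇢f′ : f ⇢ f′
          f⇢f′ = step pathQ (suc k)
          f<f′ : f < f′
          f<f′ = m<n f⇢f′
          I : Inv k
          I = advance j≤k (<-trans f<f′ k<)
          p<f′ : p < f′
          p<f′ = <-trans (p<f I) f<f′
          smaller : Ω f f′ ≼ Ω (Q k) f
          smaller = ⇢-nonincreasing (step pathQ k) f⇢f′
          pulled : Agree n (Ω f f′) v → Agree n (suffix f′) v → Agree n (suffix f) (Ω f f′)
          pulled e e′ = Agree-weaken (m≤n+m n (f′ ∸ f)) (Agree-trans
            (Agree-sym (slice-Agree (<⇒≤ f<f′) (Agree-trans e (Agree-sym e′))))
            (≗⇒Agree (≗-sym (Ω-unfold f<f′))))

        -- Every piece into which Q cuts w[q,p⁺) is shorter than α: a longer one would
        -- begin with α, and pulling α back to q would make z begin with α.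
        short : ∀ {k e} → Inv k → Q (suc k) < e → e ≤ p⁺ → e ≤ Q (suc (suc k)) → e ∸ Q (suc k) < n
        short {k} {e} I f<e e≤p⁺ e≤f′ with (e ∸ Q (suc k)) <? n
        ... | yes p = p
        ... | no ¬p = contradiction (pullback I (Agree-trans last∼f f∼v) f∼v)
                (tail-not-v (≤-trans n≤ (∸-mono e≤p⁺ (q≤f I))))
          where
          f f′ : ℕ
          f = Q (suc k)
          f′ = Q (suc (suc k))
          n≤ : n ≤ e ∸ f
          n≤ = ≮⇒≥ ¬p
          f∼next : Agree n (suffix f) (Ω f f′)
          f∼next = Agree-sym (Agree-weaken (≤-trans n≤ (∸-monoˡ-≤ f e≤f′)) (Ω-prefix (step< pathQ (suc k))))
          f∼rest : Agree n (suffix f) (Ω f p⁺)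
          f∼rest = Agree-sym (Agree-weaken (≤-trans n≤ (∸-monoˡ-≤ f e≤p⁺)) (Ω-prefix (f<p⁺ I)))
          next≼last : Ω f f′ ≼ Ω (Q k) f
          next≼last = ⇢-nonincreasing (step pathQ k) (step pathQ (suc k))
          next∼rest : Agree n (Ω f f′) (Ω f p⁺)
          next∼rest = Agree-trans (Agree-sym f∼next) f∼rest
          -- In `Ω f f′ ≼ Ω (Q k) f ≼ D ≺ Ω f p⁺`, the outer words both begin with the first `n`
          -- letters of w_f, so all four do.
          last∼f : Agree n (Ω (Q k) f) (suffix f)
          last∼f = Agree-trans (Agree-sym (sandwich next≼last (λ _ _ → refl)
            (≼-trans (descends I) (≺⇒≼ (below I))) next∼rest)) (Agree-sym f∼next)
          f∼v : Agree n (suffix f) v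
          f∼v = Agree-trans f∼next (Agree-trans (sandwich (≼-trans next≼last (descends I)) (λ _ _ → refl)
            (≺⇒≼ (below I)) next∼rest) D-prefix)

      -- The roles are exchanged, with `p⁺` inside a block of `Q`. If that block starts at `q`, the
      -- new left piece is the old common part w[p,q). Otherwise it is the whole preceding block of
      -- `Q`, which `short` bounds.
      next-crossing : ∃ λ (Y : Crossing Q P) → common Y < n × (width Y < n ⊎ width Y ≡ common X)
      next-crossing with locate pathQ {suc j} {p⁺} q<p⁺ (λ k eq → disjoint (suc i) k (sym eq))
      ... | suc k , s≤s j≤k , Qk<p⁺ , p⁺<Qk′ with m≤n⇒m<n∨m≡n j≤k
      ...   | inj₂ refl = record
                { i = suc j ; j = i ; s = p
                ; q₀<p = p<q ; p<q = q<p⁺ ; q<p⁺ = p⁺<Qk′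
                ; q₀≤s = ≤-refl ; s<p = p<q ; start = inj₁ refl }
              , short (advance ≤-refl q<p⁺) q<p⁺ ≤-refl (<⇒≤ p⁺<Qk′) , inj₂ refl
      next-crossing | suc (suc k) , s≤s _ , Qk<p⁺ , p⁺<Qk′ | inj₁ (s≤s j≤k) = record
                { i = suc (suc k) ; j = i ; s = Q (suc k)
                ; q₀<p = <-trans (p<f I) f<f′ ; p<q = Qk<p⁺ ; q<p⁺ = p⁺<Qk′
                ; q₀≤s = <⇒≤ (p<f I) ; s<p = f<f′ ; start = inj₂ (step pathQ (suc k)) }
              , short (advance (m≤n⇒m≤1+n j≤k) Qk<p⁺) Qk<p⁺ ≤-refl (<⇒≤ p⁺<Qk′)
              , inj₁ (short I f<f′ (<⇒≤ Qk<p⁺) ≤-refl)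
        where
        f<f′ : Q (suc k) < Q (suc (suc k))
        f<f′ = step< pathQ (suc k)
        I : Inv k
        I = advance j≤k (<-trans f<f′ Qk<p⁺)

    -- The larger of width and common drops in at most two steps, though not
    -- necessarily in one.
    no-crossing : ∀ b {P Q} → Path P → Path Q → Disjoint P Q → (X : Crossing P Q) →
                  width X ≤ b → common X ≤ b → ⊥
    no-crossing zero    _ _ _ X w≤0 _ = contradiction w≤0 (<⇒≱ (m<n⇒0<n∸m (Crossing.s<p X)))
    no-crossing (suc b) {P} {Q} pathP pathQ disjoint X w≤ c≤ with next-crossing pathP pathQ disjoint X
    ... | Y , cY<w , inj₁ wY<w = no-crossing b pathQ pathP disjoint′ Y (below-bound wY<w) (below-bound cY<w)
      where
      disjoint′ : Disjoint Q P
      disjoint′ i j eq = disjoint j i (sym eq)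
      below-bound : ∀ {m} → m < width X → m ≤ b
      below-bound m<w = ≤-pred (<-≤-trans m<w w≤)
    ... | Y , cY<w , inj₂ wY≡c with next-crossing pathQ pathP (λ i j eq → disjoint j i (sym eq)) Y
    ...   | Z , cZ<w , wZ = no-crossing b pathP pathQ disjoint Z
              ([ below-Y , (λ eq → ≤-trans (≤-reflexive eq) (≤-pred (<-≤-trans cY<w w≤))) ]′ wZ) (below-Y cZ<w)
      where
      below-Y : ∀ {m} → m < width Y → m ≤ b
      below-Y m<w = ≤-pred (<-≤-trans m<w (≤-trans (≤-reflexive wY≡c) c≤))

    -- The block of `Q` around `P 0` and the block of `P` around its right end form a first
    -- crossing.
    no-disjoint-paths-from-below : ∀ {P Q} → Path P → Path Q → Q 0 < P 0 → ¬ Disjoint P Q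
    no-disjoint-paths-from-below {P} {Q} pathP pathQ Q₀<P₀ disjoint
      with locate pathQ Q₀<P₀ (λ j eq → disjoint 0 j (sym eq))
    ... | j , _ , Qj<P₀ , P₀<Qj′ with locate pathP P₀<Qj′ (λ i → disjoint i (suc j))
    ...   | i , _ , Pi<Qj′ , Qj′<Pi′ = no-crossing (width X ⊔ℕ common X) pathP pathQ disjoint X
                (m≤m⊔n _ _) (m≤n⊔m _ _)
      where
      X : Crossing P Q
      X = record
        { i = i ; j = j ; s = Q j
        ; q₀<p = <-≤-trans Qj<P₀ (mono pathP z≤n) ; p<q = Pi<Qj′ ; q<p⁺ = Qj′<Pi′
        ; q₀≤s = ≤-refl ; s<p = <-≤-trans Qj<P₀ (mono pathP z≤n) ; start = inj₁ refl }

    no-disjoint-paths : ∀ {P Q} → Path P → Path Q → ¬ Disjoint P Q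
    no-disjoint-paths {P} {Q} pathP pathQ disjoint with <-cmp (P 0) (Q 0)
    ... | tri< P<Q _ _ = no-disjoint-paths-from-below pathQ pathP P<Q (λ i j eq → disjoint j i (sym eq))
    ... | tri≈ _ eq _  = disjoint 0 0 eq
    ... | tri> _ _ Q<P = no-disjoint-paths-from-below pathP pathQ Q<P disjoint

    path-unique : ∀ {P Q} → Path P → Path Q → P 0 ≡ 0 → Q 0 ≡ 0 → P ≗ Q
    path-unique {P} {Q} pathP pathQ P₀ Q₀ m with P m ≟ Q m
    ... | yes eq = eq
    ... | no neq = contradiction (λ i j eq → neq (proj₂ (shared-below (m + i) eq) (m≤m+n m i)))
                     (no-disjoint-paths (Path-drop m pathP) (Path-drop m pathQ))
      where
      -- Going back from a shared cut through unique predecessors, both paths reach the root after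
      -- equally many steps.
      shared-below : ∀ i {j} → P i ≡ Q j → i ≡ j × (∀ {k} → k ≤ i → P k ≡ Q k)
      shared-below zero {zero}  eq = refl , λ { z≤n → eq }
      shared-below zero {suc j} eq =
        contradiction (step pathQ j) (subst (λ n → ¬ Q j ⇢ n) (trans (sym P₀) eq) ¬⇢0)
      shared-below (suc i) {zero} eq =
        contradiction (step pathP i) (subst (λ n → ¬ P i ⇢ n) (sym (trans eq Q₀)) ¬⇢0)
      shared-below (suc i) {suc j} eq
        with shared-below i (⇢-unique (step pathP i) (subst (Q j ⇢_) (sym eq) (step pathQ j)))
      ... | refl , below = refl , λ k≤1+i → case m≤n⇒m<n∨m≡n k≤1+i of λ
              { (inj₁ (s≤s k≤i)) → below k≤i ; (inj₂ refl) → eq }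

    -- Translation to the language of factorizations

    ≺⇒GenLex : ∀ {x y} → x ≺ y → GenLex lt (inf x) (inf y)
    ≺⇒GenLex {x} {y} (n , e , l) =
      firstDiff (applyUpTo x n) (x n) (y n) (inf (shift (suc n) x)) (inf (shift (suc n) y))
        (subst (λ m → lt m (x n) (y n)) (sym (length-applyUpTo x n)) l)
        (inf (split x))
        (inf λ i → trans (split y i) (cong (λ u → (u ++ω ([ y n ] ++ω shift (suc n) y)) i)
          (sym (applyUpTo-cong n e))))
      where
      split : ∀ x → x ≗ applyUpTo x n ++ω ([ x n ] ++ω shift (suc n) x)
      split x = ≗-trans (≗-sym (applyUpTo-++ω x (suc n)))
        (≗-trans (λ i → cong (λ u → (u ++ω shift (suc n) x) i) (sym (applyUpTo-∷ʳ x n)))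
          (++ω-assoc (applyUpTo x n) [ x n ]))

    GenLex⇒≺ : ∀ {x y} → GenLex lt (inf x) (inf y) → x ≺ y
    GenLex⇒≺ (firstDiff u b c (inf s) (inf t) l (inf e) (inf f)) = length u ,
      FirstDiffAt-resp (n<1+n _) (≗⇒Agree (≗-sym e)) (≗⇒Agree (≗-sym f))
        (++ω-prefix u , subst₂ (lt (length u)) (sym (++ω-at u)) (sym (++ω-at u)) l)

    GenLexEq⇒≼ : ∀ {x y} → GenLexEq lt (inf x) (inf y) → x ≼ y
    GenLexEq⇒≼ (inj₁ l)       = ≺⇒≼ (GenLex⇒≺ l)
    GenLexEq⇒≼ (inj₂ (inf e)) = ≗⇒≼ e

    ≼⇒GenLexEq : ∀ {x y} → x ≼ y → GenLexEq lt (inf x) (inf y)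
    ≼⇒GenLexEq p with ≼-split p
    ... | inj₁ l = inj₁ (≺⇒GenLex l)
    ... | inj₂ e = inj₂ (inf e)

    fin^ω : ∀ {u} → u ≢ [] → fin u ^ω ≡ inf (pow u)
    fin^ω {[]}    u≢[] = contradiction refl u≢[]
    fin^ω {b ∷ u} _    = refl

    pow-≺⇒GenLex : ∀ {u v} → u ≢ [] → v ≢ [] → pow u ≺ pow v → GenLex lt (fin (u ++ v)) (fin (v ++ u))
    pow-≺⇒GenLex {u} {v} u≢[] v≢[] p with ≺⇒first-diff u≢[] v≢[] p
    ... | n , n<uv , diff
      with split-at (u ++ v) (v ++ u) n<uv (subst (n <_) (length-++-comm u v) n<uv) (proj₁ (diff {w} {w}))
    ...   | q , s , t , refl , eq , eq′ =
            firstDiff q _ _ (fin s) (fin t) (proj₂ (diff {w} {w})) (fin eq) (fin eq′)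

    GenLex⇒pow-≺ : ∀ {u v} → u ≢ [] → v ≢ [] → GenLex lt (fin (u ++ v)) (fin (v ++ u)) → pow u ≺ pow v
    -- uv and vu have equal length, so neither is a proper prefix of the other.
    GenLex⇒pow-≺ {u} {v} _ _ (properPrefix q (fin s) s≉[] (fin eq) (fin eq′)) =
      contradiction (fin (length≡0 s (+-cancelˡ-≡ (length q) _ _ (begin
        length q + length s ≡⟨ length-++ q ⟨
        length (q ++ s)     ≡⟨ cong length eq′ ⟨
        length (v ++ u)     ≡⟨ length-++-comm v u ⟩
        length (u ++ v)     ≡⟨ cong length eq ⟩
        length q            ≡⟨ +-identityʳ _ ⟨
        length q + 0        ∎)))) s≉[]
      where
      open ≡-Reasoning
      length≡0 : ∀ (s : List A) → length s ≡ 0 → s ≡ []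
      length≡0 [] _ = refl
    GenLex⇒pow-≺ {u} {v} u≢[] v≢[] (firstDiff q b c (fin s) (fin t) l (fin eq) (fin eq′)) =
      first-diff⇒≺ u≢[] v≢[] λ {x} {y} → length q ,
        FirstDiffAt-resp (n<1+n _)
          (≗⇒Agree (≗-trans (≗-sym (++ω-assoc q (b ∷ s))) λ i → cong (λ u → (u ++ω x) i) (sym eq)))
          (≗⇒Agree (≗-trans (≗-sym (++ω-assoc q (c ∷ t))) λ i → cong (λ u → (u ++ω y) i) (sym eq′)))
          (++ω-prefix q , subst₂ (lt (length q)) (sym (++ω-at q)) (sym (++ω-at q)) l)

    slice-prefix : ∀ {m u x} → suffix m ≗ u ++ω x → u ≡ slice m (m + length u) × x ≗ suffix (m + length u)
    slice-prefix {m} {u} {x} e = prefix , rest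
      where
      open ≡-Reasoning
      prefix : u ≡ slice m (m + length u)
      prefix = begin
        u                              ≡⟨ applyUpTo-prefix u x ⟨
        applyUpTo (u ++ω x) (length u) ≡⟨ applyUpTo-cong (length u) (≗⇒Agree e) ⟨
        applyUpTo (suffix m) (length u) ≡⟨ cong (applyUpTo (suffix m)) (m+n∸m≡n m (length u)) ⟨
        slice m (m + length u)         ∎
      rest : x ≗ suffix (m + length u)
      rest i = begin
        x i                           ≡⟨ shift-++ω u i ⟨
        (u ++ω x) (length u + i)      ≡⟨ e (length u + i) ⟨
        w (m + (length u + i))        ≡⟨ cong w (+-assoc m (length u) i) ⟨
        suffix (m + length u) i       ∎

    slice-split : ∀ {m n u v} → m ≤ n → slice m n ≡ u ++ v →
                  let k = m + length u in u ≡ slice m k × v ≡ slice k n × k + length v ≡ n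
    slice-split {m} {n} {u} {v} m≤n eq = u≡ , ++-cancelˡ u v (slice k n) (begin
        u ++ v                 ≡⟨ eq ⟨
        slice m n              ≡⟨ slice-++ (m≤m+n m (length u)) k≤n ⟨
        slice m k ++ slice k n ≡⟨ cong (_++ slice k n) u≡ ⟨
        u ++ slice k n         ∎) , k+|v|≡n
      where
      open ≡-Reasoning
      k : ℕ
      k = m + length u
      u≡ : u ≡ slice m k
      u≡ = proj₁ (slice-prefix (≗-trans (≗-sym (slice-++ω m≤n))
        (≗-trans (λ i → cong (λ s → (s ++ω suffix n) i) eq) (++ω-assoc u v))))
      k+|v|≡n : k + length v ≡ n
      k+|v|≡n = begin
        m + length u + length v   ≡⟨ +-assoc m (length u) (length v) ⟩
        m + (length u + length v) ≡⟨ cong (m +_) (length-++ u) ⟨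
        m + length (u ++ v)       ≡⟨ cong (λ s → m + length s) eq ⟨
        m + length (slice m n)    ≡⟨ cong (m +_) (length-slice m n) ⟩
        m + (n ∸ m)               ≡⟨ m+[n∸m]≡n m≤n ⟩
        n                         ∎
      k≤n : k ≤ n
      k≤n = subst (k ≤_) k+|v|≡n (m≤m+n k (length v))

    ⇢⇒GenLyndon : ∀ {m n} → m ⇢ n → GenLyndon lt (fin (slice m n))
    ⇢⇒GenLyndon {m} {n} s = slice≢[] (m<n s) , λ u v u≢[] v≢[] eq →
      let u≡ , v≡ , end = slice-split {u = u} {v} (<⇒≤ (m<n s)) eq in
      pow-≺⇒GenLex u≢[] v≢[] (subst₂ (λ x y → pow x ≺ pow y) (sym u≡) (sym v≡)
        (lyndon′ s (m<m+n m (length>0 u≢[])) (subst (m + length u <_) end (m<m+n _ (length>0 v≢[])))))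

    -- At an inner cut `k` the Lyndon inequality reads `Ω m k ≺ Ω k n`, which `Ω-≺-extend` brings to
    -- the required form.
    GenLyndon⇒⇢ : ∀ {m n} → m < n → GenLyndon lt (fin (slice m n)) →
                  (∀ {k} → k < m → Ω m n ≼ Ω k m) → m ⇢ n
    GenLyndon⇒⇢ m<n (_ , lyn) bound = record
      { m<n    = m<n
      ; bound  = bound
      ; lyndon = λ m<k k<n → Ω-≺-extend m<k k<n (GenLex⇒pow-≺ (slice≢[] m<k) (slice≢[] k<n)
          (lyn _ _ (slice≢[] m<k) (slice≢[] k<n) (sym (slice-++ (<⇒≤ m<k) (<⇒≤ k<n)))))
      }

    GenLyndon-suffix : ∀ {m} → (∀ {k} → m < k → suffix m ≺ suffix k) → GenLyndon lt (inf (suffix m))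
    GenLyndon-suffix {m} strict u v u≢[] eq = ≺⇒GenLex (≺-resp (λ _ → refl)
      (≗-sym (proj₂ (slice-prefix {m} {u} eq))) (strict (m<m+n m (length>0 u≢[]))))

    GenLyndon-suffix⁻¹ : ∀ {m x} → x ≗ suffix m → GenLyndon lt (inf x) → ∀ {k} → m < k → suffix m ≺ suffix k
    GenLyndon-suffix⁻¹ e lyn m<k = ≺-resp e (λ _ → refl) (GenLex⇒≺ (lyn (slice _ _) (suffix _) (slice≢[] m<k)
      (≗-trans e (≗-sym (slice-++ω (<⇒≤ m<k))))))

    _≽ω_ : Rel (Word A) (a ⊔ ℓ)
    l ≽ω m = GenLexEq lt (m ^ω) (l ^ω)

    ≽ω⇒≼ : ∀ {l m x y} → l ^ω ≡ inf x → m ^ω ≡ inf y → l ≽ω m → y ≼ x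
    ≽ω⇒≼ eq eq′ p = GenLexEq⇒≼ (subst₂ (GenLexEq lt) eq′ eq p)

    ≼⇒≽ω : ∀ {l m x y} → l ^ω ≡ inf x → m ^ω ≡ inf y → y ≼ x → l ≽ω m
    ≼⇒≽ω eq eq′ p = subst₂ (GenLexEq lt) (sym eq′) (sym eq) (≼⇒GenLexEq p)

    partialProduct-suc : ∀ (f : ℕ → List A) n → partialProduct f (suc n) ≡ partialProduct f n ++ f n
    partialProduct-suc f n = begin
      concat (applyUpTo f (suc n))                ≡⟨ cong concat (applyUpTo-∷ʳ f n) ⟨
      concat (applyUpTo f n ∷ʳ f n)               ≡⟨ concat-++ (applyUpTo f n) [ f n ] ⟨
      concat (applyUpTo f n) ++ concat [ f n ]    ≡⟨ cong (concat (applyUpTo f n) ++_) (++-identityʳ (f n)) ⟩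
      concat (applyUpTo f n) ++ f n               ∎
      where open ≡-Reasoning

    -- Infinite factorizations and paths

    blocks : (ℕ → ℕ) → (ℕ → List A)
    blocks c i = slice (c i) (c (suc i))

    path-factorization : ∀ {c} → Path c → c 0 ≡ 0 →
                         NonincreasingLyndonFactorization lt (inf w) (infinite (blocks c))
    path-factorization {c} path c₀ = record
      { product       = (λ n → inf (suffix (c n)) , inf λ i → sym (trans
                          (cong (λ u → (u ++ω suffix (c n)) i) (pp n)) (slice-++ω {0} {c n} z≤n i)))
                      -- Blocks are nonempty, so |u| of them cover `u`.
                      , λ { u (inf x , inf e) → length u , fin (slice (length u) (c (length u))) ,
                          fin (trans (pp (length u)) (trans (sym (slice-++ z≤n (grows path (length u))))
                            (cong (_++ slice (length u) (c (length u))) (sym (proj₁ (slice-prefix {0} {u} e)))))) }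
      ; lyndon        = infinite λ i → ⇢⇒GenLyndon (step path i)
      ; nonincreasing = infinite λ i → ≼⇒≽ω {fin (blocks c i)} {fin (blocks c (suc i))}
                          (fin^ω (slice≢[] (step< path i))) (fin^ω (slice≢[] (step< path (suc i))))
                          (⇢-nonincreasing (step path i) (step path (suc i)))
      }
      where
      pp : ∀ n → partialProduct (blocks c) n ≡ slice 0 (c n)
      pp zero    = cong (slice 0) (sym c₀)
      pp (suc n) = trans (partialProduct-suc (blocks c) n)
        (trans (cong (_++ blocks c n) (pp n)) (slice-++ z≤n (<⇒≤ (step< path n))))

    factorization-path : ∀ {f} → NonincreasingLyndonFactorization lt (inf w) (infinite f) →
                         ∃ λ c → Path c × c 0 ≡ 0 × f ≗ blocks c
    factorization-path {f} F with NonincreasingLyndonFactorization.lyndon F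
                                | NonincreasingLyndonFactorization.nonincreasing F
    ... | infinite lyn | infinite dec = c , mkPath steps , refl , f≡
      where
      c : ℕ → ℕ
      c n = length (partialProduct f n)

      pp : ∀ n → partialProduct f n ≡ slice 0 (c n)
      pp n with proj₁ (NonincreasingLyndonFactorization.product F) n
      ... | inf x , inf e = proj₁ (slice-prefix e)

      f≢[] : ∀ n → f n ≢ []
      f≢[] n = proj₁ (lyn n)

      c-suc : ∀ n → c n + length (f n) ≡ c (suc n)
      c-suc n = sym (trans (cong length (partialProduct-suc f n)) (length-++ (partialProduct f n)))

      c< : ∀ n → c n < c (suc n)
      c< n = subst (c n <_) (c-suc n) (m<m+n (c n) (length>0 (f≢[] n)))

      f≡ : f ≗ blocks c
      f≡ n = proj₁ (proj₂ (slice-split {0} z≤n (trans (sym (pp (suc n))) (partialProduct-suc f n))))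

      block^ω : ∀ n → fin (f n) ^ω ≡ inf (Ω (c n) (c (suc n)))
      block^ω n = trans (fin^ω (f≢[] n)) (cong (inf ∘ pow) (f≡ n))

      steps : ∀ n → c n ⇢ c (suc n)
      steps n = GenLyndon⇒⇢ (c< n) (subst (GenLyndon lt ∘ fin) (f≡ n) (lyn n)) (bounds n)
        where
        -- `dec` compares only neighbouring factors; minimality of the preceding step extends the
        -- bound to every earlier `k`.
        bounds : ∀ n {k} → k < c n → Ω (c n) (c (suc n)) ≼ Ω k (c n)
        bounds (suc n) k<c = ≼-trans (≽ω⇒≼ {fin (f n)} {fin (f (suc n))} (block^ω n) (block^ω (suc n)) (dec n))
          (minimal (steps n) k<c)

    -- Finite factorizations and branches from the root

    data Cut : List (List A) → ℕ → Set (a ⊔ ℓ) where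
      nil  : Cut [] 0
      snoc : ∀ {us m n} → Cut us m → m ⇢ n → Cut (us ∷ʳ slice m n) n

    Cut-unique : ∀ {us vs n} → Cut us n → Cut vs n → us ≡ vs
    Cut-unique nil        nil        = refl
    Cut-unique nil        (snoc _ t) = contradiction t ¬⇢0
    Cut-unique (snoc _ s) nil        = contradiction s ¬⇢0
    Cut-unique (snoc p s) (snoc q t) with ⇢-unique s t
    ... | refl = cong (_∷ʳ _) (Cut-unique p q)

    Cut-exists : ∀ n → ∃ λ us → Cut us n
    Cut-exists = λ n → extend nil (0⇢* n)
      where
      extend : ∀ {us m n} → Cut us m → m ⇢* n → ∃ λ vs → Cut vs n
      extend p ε        = _ , p
      extend p (s ◅ ss) = extend (snoc p s) ss

    Cut-concat : ∀ {us n} → Cut us n → concat us ≡ slice 0 n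
    Cut-concat nil = refl
    Cut-concat (snoc {us} {m} {n} p s) = begin
      concat (us ∷ʳ slice m n)                ≡⟨ concat-++ us [ slice m n ] ⟨
      concat us ++ concat [ slice m n ]       ≡⟨ cong₂ _++_ (Cut-concat p) (++-identityʳ (slice m n)) ⟩
      slice 0 m ++ slice m n                  ≡⟨ slice-++ z≤n (<⇒≤ (m<n s)) ⟩
      slice 0 n                               ∎
      where open ≡-Reasoning

    Cut-All : ∀ {us n l} → Cut us n → GenLyndon lt l → All (GenLyndon lt) (map fin us ∷ʳ l)
    Cut-All nil lyn = lyn ∷ []
    Cut-All (snoc {us} p s) lyn = ∷ʳ⁺ (subst (All (GenLyndon lt)) (sym (map-++ fin us [ _ ]))
      (Cut-All p (⇢⇒GenLyndon s))) lyn

    Linked-snoc : ∀ {xs x y} → Linked _≽ω_ (xs ∷ʳ x) → x ≽ω y → Linked _≽ω_ ((xs ∷ʳ x) ∷ʳ y)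
    Linked-snoc {[]}         [-]      r = r ∷ [-]
    Linked-snoc {_ ∷ []}     (q ∷ qs) r = q ∷ Linked-snoc {[]} qs r
    Linked-snoc {_ ∷ y ∷ xs} (q ∷ qs) r = q ∷ Linked-snoc {y ∷ xs} qs r

    -- The hypothesis on `x` has the shape of the field `bound`, so each step supplies it for the
    -- shorter branch.
    Cut-Linked : ∀ {us n l x} → Cut us n → l ^ω ≡ inf x → (∀ {k} → k < n → x ≼ Ω k n) →
                 Linked _≽ω_ (map fin us ∷ʳ l)
    Cut-Linked nil _ _ = [-]
    Cut-Linked {l = l} (snoc {us} {m} {n} p s) l^ω bound′ =
      subst (λ xs → Linked _≽ω_ (xs ∷ʳ l)) (sym (map-++ fin us [ _ ]))
        (Linked-snoc (Cut-Linked p slice^ω (bound s)) (≼⇒≽ω {fin (slice m n)} {l} slice^ω l^ω (bound′ (m<n s))))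
      where
      slice^ω = fin^ω (slice≢[] (m<n s))

    first : List (List A) → Word A → Word A
    first []      l = l
    first (v ∷ _) _ = fin v

    Linked-uncons : ∀ {y} vs {l} → Linked _≽ω_ (y ∷ (map fin vs ∷ʳ l)) → y ≽ω first vs l × Linked _≽ω_ (map fin vs ∷ʳ l)
    Linked-uncons []      (r ∷ rs) = r , rs
    Linked-uncons (_ ∷ _) (r ∷ rs) = r , rs

    -- Factors are consumed from the left. The last hypothesis bounds the power of the next factor,
    -- and `minimal` renews it after each new edge.
    Cut-extend : ∀ {us m x} vs → Cut us m → suffix m ≗ concat vs ++ω x →
      All (GenLyndon lt) (map fin vs ∷ʳ inf x) → Linked _≽ω_ (map fin vs ∷ʳ inf x) →
      (∀ {y k} → first vs (inf x) ^ω ≡ inf y → k < m → y ≼ Ω k m) →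
      ∃ λ n → Cut (us ++ vs) n × x ≗ suffix n × (∀ {k} → k < n → x ≼ Ω k n)
    Cut-extend {us} {m} [] p e _ _ bound = m , subst (λ us → Cut us m) (sym (++-identityʳ us)) p , ≗-sym e , bound refl
    Cut-extend {us} {m} {x} (v ∷ vs) p e (lyn ∷ lyns) linked bound =
      let n′ , p′ , r = Cut-extend vs (subst (λ u → Cut (us ∷ʳ u) n) (sym v≡) (snoc p m⇢n)) (≗-sym rest) lyns linked′
                          (λ {y} eq k<n → ≼-trans (≽ω⇒≼ {fin v} {first vs (inf x)} v^ω eq v≽next) (minimal m⇢n k<n))
      in n′ , subst (λ us → Cut us n′) (++-assoc us [ v ] vs) p′ , r
      where
      n : ℕ
      n = m + length v
      prefix : v ≡ slice m n × concat vs ++ω x ≗ suffix n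
      prefix = slice-prefix (≗-trans e (++ω-assoc v (concat vs)))
      v≡ = proj₁ prefix
      rest = proj₂ prefix
      v≽next = proj₁ (Linked-uncons vs linked)
      linked′ = proj₂ (Linked-uncons vs linked)
      v^ω : fin v ^ω ≡ inf (Ω m n)
      v^ω = trans (fin^ω (proj₁ lyn)) (cong (inf ∘ pow) v≡)
      m⇢n : m ⇢ n
      m⇢n = GenLyndon⇒⇢ (m<m+n m (length>0 (proj₁ lyn))) (subst (GenLyndon lt ∘ fin) v≡ lyn) (bound v^ω)

    finite-factorization : ∀ {m us} → StrictlyMinimalSuffix m → Cut us m →
                           NonincreasingLyndonFactorization lt (inf w) (finite us (inf (suffix m)))
    finite-factorization {m} (min , strict) p = record
      { product       = inf λ i → sym (trans (cong (λ u → (u ++ω suffix m) i) (Cut-concat p)) (slice-++ω {0} {m} z≤n i))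
      ; lyndon        = finite (Cut-All p (GenLyndon-suffix strict))
      ; nonincreasing = finite (Cut-Linked p refl λ k<m → ≼suffix⇒≼Ω k<m (min _))
      }

    finite-factorization⁻¹ : ∀ {us l} → NonincreasingLyndonFactorization lt (inf w) (finite us l) →
                             ∃ λ m → StrictlyMinimalSuffix m × Cut us m × inf (suffix m) ≈ l
    finite-factorization⁻¹ {us} {inf x}
      record { product = inf e ; lyndon = finite lyn ; nonincreasing = finite dec }
      with Cut-extend us nil e lyn dec (λ _ ())
    ... | m , p , x≗ , bound′ = m , (min , strict) , p , inf (≗-sym x≗)
      where
      strict : ∀ {k} → m < k → suffix m ≺ suffix k
      strict = GenLyndon-suffix⁻¹ x≗ (proj₂ (∷ʳ⁻ lyn))
      min : MinimalSuffix m
      min k with <-cmp k m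
      ... | tri< k<m _ _  = ≼Ω⇒≼suffix k<m (≼-resp x≗ (λ _ → refl) (bound′ k<m))
      ... | tri≈ _ refl _ = ≗⇒≼ λ _ → refl
      ... | tri> _ _ m<k  = ≺⇒≼ (strict m<k)

    StrictlyMinimalSuffix-unique : ∀ {m n} → StrictlyMinimalSuffix m → StrictlyMinimalSuffix n → m ≡ n
    StrictlyMinimalSuffix-unique {m} {n} (min , strict) (min′ , strict′) with <-cmp m n
    ... | tri< m<n _ _ = contradiction (strict m<n) (min′ m)
    ... | tri≈ _ eq _  = eq
    ... | tri> _ _ n<m = contradiction (strict′ n<m) (min n)

    -- Existence and uniqueness combined

    factorization-∃! : ∃! _≋_ (NonincreasingLyndonFactorization lt (inf w))
    factorization-∃! with em {∃ StrictlyMinimalSuffix}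
    ... | yes (m , sm) = finite us (inf (suffix m)) , finite-factorization sm p , unique
      where
      us = proj₁ (Cut-exists m)
      p = proj₂ (Cut-exists m)
      unique : ∀ {F} → NonincreasingLyndonFactorization lt (inf w) F → finite us (inf (suffix m)) ≋ F
      unique {finite vs l} F with finite-factorization⁻¹ F
      ... | n , sm′ , q , e with StrictlyMinimalSuffix-unique sm sm′
      ...   | refl = finite (Cut-unique p q) e
      unique {infinite f} F = let _ , path , _ = factorization-path F in
        ⊥-elim (path-excludes-Lyndon-suffix path (proj₂ sm))
    ... | no none with ∃-path none
    ...   | c , c₀ , path = infinite (blocks c) , path-factorization path c₀ , unique
      where
      unique : ∀ {F} → NonincreasingLyndonFactorization lt (inf w) F → infinite (blocks c) ≋ F
      unique {finite vs l} F = let m , sm , _ = finite-factorization⁻¹ F in contradiction (m , sm) none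
      unique {infinite f} F = let c′ , path′ , c′₀ , f≗ = factorization-path F
                                  c≗c′ = path-unique path path′ c₀ c′₀ in
        infinite λ i → trans (cong₂ slice (c≗c′ i) (c≗c′ (suc i))) (sym (f≗ i))

theorem7 : ∀ {a ℓ} → ExcludedMiddle (a ⊔ ℓ) →
    {A : Set a} (lt : ℕ → Rel A ℓ) → (∀ n → IsStrictTotalOrder _≡_ (lt n)) →
    (w : ℕ → A) → ∃! _≋_ (NonincreasingLyndonFactorization lt (inf w))
theorem7 em lt sto w = Order.Cuts.factorization-∃! em lt sto w
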